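{- Let $G=(V,E)$ be a finite graph with at least one vertex and let $w\ge k>0$ be integers. The following are equivalent: (i) $G$ has an $\mathcal F^w_k$-tangle of $S_k$; (ii) $G$ has no $S_k$-tree over $\mathcal F^w_k$; (iii) $G$ has no tree-decomposition of width $<w-1$ and adhesion $<k$.
   Context: An (oriented vertex) separation of $G$ is a pair $(A,B)$ of (possibly empty) subsets of $V$ with $A\cup B=V$ and no edge between $A\setminus B$ and $B\setminus A$, ordered by $(A,B)\le(C,D)$ iff $A\subseteq C$, $B\supseteq D$, with inverse $(B,A)$; $\{A,B\}$ is the unoriented separation, of order $|A\cap B|$. $\vec S_k$: oriented separations of order $<k$; $S_k$: unoriented ones. An orientation of $S_k$ is a set $O\subseteq\vec S_k$ containing exactly one of $(A,B),(B,A)$ for each $\{A,B\}\in S_k$; it is consistent if there are no $(A,B),(C,D)\in\vec S_k$ with $\{A,B\}\ne\{C,D\}$, $(A,B)<(C,D)$, $(B,A)\in O$, $(C,D)\in O$. A star is a set $\sigma$ with $(A,B)\ne(B,A)$ for each element and $(A,B)\le(D,C)$ for distinct $(A,B),(C,D)\in\sigma$. $\mathcal F^w_k$ is the set of stars $\{(A_i,B_i):i=0,\dots,n\}\subseteq\vec S_k$ with $|\bigcap_{i=0}^nB_i|<w$ (intersection $=V$ for the empty star). An $\mathcal F^w_k$-tangle of $S_k$ is a consistent orientation of $S_k$ with no subset in $\mathcal F^w_k$. An $S_k$-tree over $\mathcal F^w_k$ is a pair $(T,\alpha)$, $T$ a finite tree with at least one node, $\alpha$ assigning to each ordered pair $(x,y)$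 with $xy\in E(T)$ an element $\alpha(x,y)\in\vec S_k$ with $\alpha(y,x)$ the inverse of $\alpha(x,y)$ and $\{\alpha(x,t):xt\in E(T)\}\in\mathcal F^w_k$ for every node $t$. The adhesion of a tree-decomposition $(T,(V_t)_{t\in T})$ is $\max_{st\in E(T)}|V_s\cap V_t|$ (and $0$ if $T$ has one node); its width is $\max_t|V_t|-1$. -}

module Defs where

open import Data.Nat using (ℕ; suc; _<_; _≤_)
open import Data.Integer as ℤ using (ℤ; +_)
open import Data.Bool using (Bool; true; false; if_then_else_)
open import Data.Fin using (Fin)
open import Data.Fin.Subset using (Subset; _∈_; _∉_; _⊆_; _∩_; _∪_; ⊤; ⋂; ∣_∣)
open import Data.List using (List; []; _∷_; map; concatMap; [_]; allFin)
open import Data.List.Membership.Propositional using () renaming (_∈_ to _∈ₗ_)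
open import Data.List.Relation.Unary.All using (All)
open import Data.List.Relation.Unary.Unique.Propositional using (Unique)
open import Data.Product using (Σ; _×_; _,_; proj₁; proj₂; ∃)
open import Data.Sum using (_⊎_)
open import Relation.Nullary using (¬_)
open import Relation.Binary.PropositionalEquality using (_≡_; _≢_)
open import Data.List using (length)
import Data.Fin as F

record Graph (n : ℕ) : Set where
  field
    E      : Fin n → Fin n → Bool
    E-sym  : ∀ u v → E u v ≡ E v u
    E-irr  : ∀ u → E u u ≡ false

open Graph public

Sep : ℕ → Set
Sep n = Subset n × Subset n

inv : ∀ {n} → Sep n → Sep n
inv (A , B) = (B , A)

IsSeparation : ∀ {n} → Graph n → Sep n → Set
IsSeparation {n} G (A , B) =
  (A ∪ B ≡ ⊤) ×
  (∀ u v → u ∈ A → u ∉ B → v ∈ B → v ∉ A → E G u v ≡ false)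

order : ∀ {n} → Sep n → ℕ
order (A , B) = ∣ A ∩ B ∣

InSk : ∀ {n} → Graph n → ℕ → Sep n → Set
InSk G k s = IsSeparation G s × order s < k

_≤ₛ_ : ∀ {n} → Sep n → Sep n → Set
(A , B) ≤ₛ (C , D) = (A ⊆ C) × (D ⊆ B)

_<ₛ_ : ∀ {n} → Sep n → Sep n → Set
s <ₛ t = (s ≤ₛ t) × (s ≢ t)

SameUnoriented : ∀ {n} → Sep n → Sep n → Set
SameUnoriented s t = (s ≡ t) ⊎ (s ≡ inv t)

-- Stars and F^w_k  (a finite set of oriented separations is given by a
-- list; duplicates are harmless, all conditions refer to elements)

IsStar : ∀ {n} → List (Sep n) → Set
IsStar σ =
  (∀ s → s ∈ₗ σ → s ≢ inv s) ×
  (∀ s t → s ∈ₗ σ → t ∈ₗ σ → s ≢ t → s ≤ₛ inv t)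

-- ⋂ B_i (equal to V for the empty star)
interB : ∀ {n} → List (Sep n) → Subset n
interB σ = ⋂ (map proj₂ σ)

InF : ∀ {n} → Graph n → (w k : ℕ) → List (Sep n) → Set
InF G w k σ = All (InSk G k) σ × IsStar σ × ∣ interB σ ∣ < w

IsOrientation : ∀ {n} → Graph n → ℕ → (Sep n → Bool) → Set
IsOrientation G k O =
  (∀ s → O s ≡ true → InSk G k s) ×
  (∀ s → InSk G k s → (O s ≡ true) ⊎ (O (inv s) ≡ true)) ×
  (∀ s → InSk G k s → O s ≡ true → O (inv s) ≡ true → s ≡ inv s)

IsConsistent : ∀ {n} → Graph n → ℕ → (Sep n → Bool) → Set
IsConsistent G k O =
  ∀ s t → InSk G k s → InSk G k t → ¬ SameUnoriented s t → s <ₛ t →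
    O (inv s) ≡ true → O t ≡ true → Data.Empty.⊥
  where import Data.Empty

IsTangle : ∀ {n} → Graph n → (w k : ℕ) → (Sep n → Bool) → Set
IsTangle G w k O =
  IsOrientation G k O × IsConsistent G k O ×
  (∀ (σ : List (Sep _)) → All (λ s → O s ≡ true) σ → ¬ InF G w k σ)

HasTangle : ∀ {n} → Graph n → (w k : ℕ) → Set
HasTangle {n} G w k = Σ (Sep n → Bool) (IsTangle G w k)

data Walk {m : ℕ} (adj : Fin m → Fin m → Bool) : Fin m → Fin m → Set where
  here : ∀ x → Walk adj x x
  step : ∀ {x y z} → adj x y ≡ true → Walk adj y z → Walk adj x z

walkVerts : ∀ {m} {adj : Fin m → Fin m → Bool} {x y} → Walk adj x y → List (Fin m)
walkVerts (here x) = x ∷ []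
walkVerts (step {x = x} _ p) = x ∷ walkVerts p

IsPath : ∀ {m} {adj : Fin m → Fin m → Bool} {x y} → Walk adj x y → Set
IsPath p = Unique (walkVerts p)

HasCycle : ∀ {m} → (Fin m → Fin m → Bool) → Set
HasCycle {m} adj =
  Σ (Fin m) λ x → Σ (Fin m) λ y → Σ (Walk adj x y) λ p →
    IsPath p × (3 ≤ length (walkVerts p)) × (adj y x ≡ true)

record Tree (m : ℕ) : Set where
  field
    adj        : Fin m → Fin m → Bool
    adj-sym    : ∀ x y → adj x y ≡ adj y x
    adj-irr    : ∀ x → adj x x ≡ false
    connected  : ∀ x y → Walk adj x y
    acyclic    : ¬ HasCycle adj

open Tree public

incoming : ∀ {n m} → Tree m → (Fin m → Fin m → Sep n) → Fin m → List (Sep n)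
incoming {m = m} T α t =
  concatMap (λ x → if adj T x t then [ α x t ] else []) (allFin m)

IsSkTree : ∀ {n m} → Graph n → (w k : ℕ) → Tree m → (Fin m → Fin m → Sep n) → Set
IsSkTree G w k T α =
  (∀ x y → adj T x y ≡ true → InSk G k (α x y)) ×
  (∀ x y → adj T x y ≡ true → α y x ≡ inv (α x y)) ×
  (∀ t → InF G w k (incoming T α t))

HasSkTree : ∀ {n} → Graph n → (w k : ℕ) → Set
HasSkTree {n} G w k =
  Σ ℕ λ m → Σ (Tree (suc m)) λ T → Σ (Fin (suc m) → Fin (suc m) → Sep n) λ α →
    IsSkTree G w k T α

IsTreeDecomposition : ∀ {n m} → Graph n → Tree m → (Fin m → Subset n) → Set
IsTreeDecomposition {n} {m} G T V =
  (∀ v → ∃ λ t → v ∈ V t) ×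
  (∀ u v → E G u v ≡ true → ∃ λ t → (u ∈ V t) × (v ∈ V t)) ×
  (∀ t₁ t₂ t₃ → (p : Walk (adj T) t₁ t₃) → IsPath p → t₂ ∈ₗ walkVerts p →
     (V t₁ ∩ V t₃) ⊆ V t₂)

-- width < w - 1   (width = max_t |V_t| - 1, computed in ℤ)
WidthBelow : ∀ {m n} → (Fin m → Subset n) → ℕ → Set
WidthBelow V c = ∀ t → (+ ∣ V t ∣ ℤ.- + 1) ℤ.< (+ c ℤ.- + 1)

-- adhesion < k   (adhesion = max over tree edges of |V_s ∩ V_t|, 0 if no edges)
AdhesionBelow : ∀ {m n} → Tree m → (Fin m → Subset n) → ℕ → Set
AdhesionBelow T V k = (0 < k) × (∀ s t → adj T s t ≡ true → ∣ V s ∩ V t ∣ < k)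

HasSmallTD : ∀ {n} → Graph n → (w k : ℕ) → Set
HasSmallTD {n} G w k =
  Σ ℕ λ m → Σ (Tree (suc m)) λ T → Σ (Fin (suc m) → Subset n) λ V →
    IsTreeDecomposition G T V × WidthBelow V w × AdhesionBelow T V k

{-# OPTIONS --safe #-}
module Submission where

-- A partial orientation X of S_k, closed downwards, is enlarged until it either is a tangle or
-- conflicts with itself: some u ∈ X has its inverse derivable from X by stars, i.e. the far side
-- of u has a tree decomposition with small bags and leaves in X. Initially X consists of the
-- separations (A , V) with |A| < k; a conflict for this X is a small tree decomposition of G.
-- If X leaves something unoriented, let s be a minimal such separation and s′ ≤ s* another.
-- Adding s, respectively s′, to X gives a tangle, or a conflict for X, or derivations of s* and
-- s′* from X. In the last case choose t of minimal order between s′ and s*: by submodularity both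
-- derivations can be shifted, without enlarging any bag or separator, to derivations of t and t*,
-- which are joined along t. Re-rooting the joined tree at any of its leaves is a conflict for X.
--
-- Conversely, the edges of a small tree decomposition induce an S_k-tree, and a tangle would
-- orient the edges of such a tree without a sink, which a finite tree does not allow.

open import Defs
open import Axiom.UniquenessOfIdentityProofs using (module Decidable⇒UIP)
open import Data.Bool as Bool using (Bool; true; false; _∧_; _∨_; if_then_else_)
open import Data.Empty as Empty using (⊥-elim)
open import Data.Fin as Fin using (Fin; zero; suc)
open import Data.Fin.Properties using (all?; any?; pigeonhole)
open import Data.Fin.Subset using (Subset; _∈_; _∉_; _⊆_; _∩_; _∪_; ∁; ⊤; ⊥; ⋂; ⋃; ∣_∣)
open import Data.Fin.Subset.Properties
  using (_∈?_; _⊆?_; anySubset?; x∈p∩q⁺; x∈p∩q⁻; x∈p∪q⁺; x∈p∪q⁻; p∩q⊆p; p∩q⊆q; p⊆p∪q; q⊆p∪q;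
         ∩-comm; ∩-assoc; drop-there; ∈⊤; ∉⊥; ⊥⊆; ⊆⊤; ⊆-antisym; ⊆-refl; ⊆-trans; ⊆-reflexive;
         p⊆q⇒∣p∣≤∣q∣; p⊂q⇒∣p∣<∣q∣; p⊆q⇒∁p⊇∁q; x∉p⇒x∈∁p; x∈∁p⇒x∉p; ∣⊥∣≡0)
import Data.Integer as ℤ
import Data.Integer.Properties as ℤ
open import Data.List
  using (List; []; _∷_; _++_; [_]; map; filter; deduplicate; cartesianProduct; length; lookup; allFin)
open import Data.List.Membership.Propositional using () renaming (_∈_ to _∈ₗ_)
open import Data.List.Membership.Propositional.Properties
  using (∈-map⁺; ∈-++⁺ˡ; ∈-++⁺ʳ; ∈-filter⁺; ∈-filter⁻; ∈-cartesianProduct⁺; ∈-deduplicate⁺;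
         ∈-concatMap⁺; ∈-concatMap⁻; ∈-allFin; ∈-lookup)
open import Data.List.Properties using (filter-notAll; length-map)
open import Data.List.Relation.Binary.Permutation.Propositional
  using (_↭_; ↭⇒↭ₛ) renaming (refl to ↭refl; prep to ↭prep; swap to ↭swap; trans to ↭trans)
open import Data.List.Relation.Binary.Permutation.Propositional.Properties using (All-resp-↭)
open import Data.List.Relation.Unary.All as All using (All; []; _∷_)
import Data.List.Relation.Unary.All.Properties as All
open import Data.List.Relation.Unary.AllPairs as AllPairs using (AllPairs; []; _∷_)
import Data.List.Relation.Unary.AllPairs.Properties as AllPairs
open import Data.List.Relation.Unary.Any as Any using (Any; here; there)
open import Data.Nat using (ℕ; zero; suc; _+_; _<_; _≤_; z≤n; s≤s; _<?_)
open import Data.Nat.Induction using (<-wellFounded)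
import Data.Nat.Properties as ℕ
open import Data.Product using (Σ; ∃; ∃₂; _×_; _,_; proj₁; proj₂; uncurry)
open import Data.Product.Properties using (≡-dec)
open import Data.Sum as Sum using (_⊎_; inj₁; inj₂; [_,_]′)
import Data.Unit as Unit
open import Data.Vec as Vec using ([]; _∷_; tabulate)
import Data.Vec.Properties as Vec
open import Function using (_∘_; id)
open import Function.Bundles using (_⇔_; mk⇔)
open import Induction.WellFounded using (Acc; acc)
open import Relation.Binary.PropositionalEquality
  using (_≡_; _≢_; refl; sym; trans; cong; cong₂; subst; subst₂; setoid; resp₂)
open import Relation.Nullary using (¬_; Dec; yes; no; ¬?; _×-dec_; _→-dec_; contradiction)
open import Relation.Nullary.Decidable using (map′; ⌊_⌋)

private variable n : ℕ

-- Cardinalities of subsets and submodularity.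

bit : Bool → ℕ
bit true  = 1
bit false = 0

∣∷∣ : ∀ b (p : Subset n) → ∣ b ∷ p ∣ ≡ bit b + ∣ p ∣
∣∷∣ true  p = refl
∣∷∣ false p = refl

-- The contribution of one vertex to `∣∣-submodular`. If both terms on the left are 1, then `u`,
-- `d`, `i`, `c` all hold and both terms on the right are 1. If only the second is 1, then `d` gives
-- `c ∧ d`, and `j` gives `u ∧ i` by the hypothesis.
bit-submodular : ∀ u d i c j → (j ≡ true → u ≡ true) →
  bit ((u ∧ d) ∧ (i ∨ c)) + bit ((i ∧ c) ∧ (j ∨ d)) ≤ bit (u ∧ i) + bit (c ∧ d)
bit-submodular true  true  true  true  j     h = s≤s (ℕ.≤-reflexive (cong bit (∨-true j)))
  where
    ∨-true : ∀ j → j ∨ true ≡ true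
    ∨-true true  = refl
    ∨-true false = refl
bit-submodular true  true  true  false j     h = ℕ.≤-refl
bit-submodular true  true  false true  j     h = ℕ.≤-refl
bit-submodular true  true  false false j     h = z≤n
bit-submodular true  false true  true  true  h = ℕ.≤-refl
bit-submodular true  false true  true  false h = z≤n
bit-submodular true  false true  false j     h = z≤n
bit-submodular true  false false c     j     h = z≤n
bit-submodular false d     i     c     true  h with () ← h refl
bit-submodular false true  true  true  false h = ℕ.≤-refl
bit-submodular false false true  true  false h = z≤n
bit-submodular false d     true  false false h = z≤n
bit-submodular false d     false c     false h = z≤n

-- For J = U, I = W this is submodularity of the order of vertex separations; for a star
-- with I the intersection of the B-sides and J the union of the A-sides it compares bags.
∣∣-submodular : (U D I C J : Subset n) → J ⊆ U →
  ∣ (U ∩ D) ∩ (I ∪ C) ∣ + ∣ (I ∩ C) ∩ (J ∪ D) ∣ ≤ ∣ U ∩ I ∣ + ∣ C ∩ D ∣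
∣∣-submodular [] [] [] [] [] J⊆U = z≤n
∣∣-submodular (u ∷ U) (d ∷ D) (i ∷ I) (c ∷ C) (j ∷ J) J⊆U
  rewrite ∣∷∣ ((u ∧ d) ∧ (i ∨ c)) ((U ∩ D) ∩ (I ∪ C))
        | ∣∷∣ ((i ∧ c) ∧ (j ∨ d)) ((I ∩ C) ∩ (J ∪ D))
        | ∣∷∣ (u ∧ i) (U ∩ I) | ∣∷∣ (c ∧ d) (C ∩ D) = begin
  (a + p) + (b + q) ≡⟨ interchange a p b q ⟩
  (a + b) + (p + q) ≤⟨ ℕ.+-mono-≤ (bit-submodular u d i c j (λ { refl → Vec.[]=⇒lookup (J⊆U Vec.here) }))
                                  (∣∣-submodular U D I C J (λ x∈J → drop-there (J⊆U (Vec.there x∈J)))) ⟩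
  (a′ + b′) + (p′ + q′) ≡⟨ interchange a′ b′ p′ q′ ⟩
  (a′ + p′) + (b′ + q′) ∎
  where
    open ℕ.≤-Reasoning
    open import Algebra.Properties.CommutativeSemigroup ℕ.+-commutativeSemigroup using (interchange)
    a  = bit ((u ∧ d) ∧ (i ∨ c))
    b  = bit ((i ∧ c) ∧ (j ∨ d))
    a′ = bit (u ∧ i)
    b′ = bit (c ∧ d)
    p  = ∣ (U ∩ D) ∩ (I ∪ C) ∣
    q  = ∣ (I ∩ C) ∩ (J ∪ D) ∣
    p′ = ∣ U ∩ I ∣
    q′ = ∣ C ∩ D ∣

⊆∧∣≥∣⇒≡ : {p q : Subset n} → p ⊆ q → ∣ q ∣ ≤ ∣ p ∣ → p ≡ q
⊆∧∣≥∣⇒≡ {p = p} {q} p⊆q ∣q∣≤∣p∣ = ⊆-antisym p⊆q q⊆p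
  where
    q⊆p : q ⊆ p
    q⊆p {x} x∈q with x ∈? p
    ... | yes x∈p = x∈p
    ... | no  x∉p = contradiction ∣q∣≤∣p∣ (ℕ.<⇒≱ (p⊂q⇒∣p∣<∣q∣ (p⊆q , x , x∈q , x∉p)))

∈⋂⁺ : ∀ {x} {ps : List (Subset n)} → All (x ∈_) ps → x ∈ ⋂ ps
∈⋂⁺ []       = ∈⊤
∈⋂⁺ (h ∷ hs) = x∈p∩q⁺ (h , ∈⋂⁺ hs)

∈⋂⁻ : ∀ {x} (ps : List (Subset n)) → x ∈ ⋂ ps → All (x ∈_) ps
∈⋂⁻ []       _ = []
∈⋂⁻ (p ∷ ps) h with x∈p∩q⁻ p (⋂ ps) h
... | x∈p , x∈ps = x∈p ∷ ∈⋂⁻ ps x∈ps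

fromPred : {P : Fin n → Set} → (∀ x → Dec (P x)) → Subset n
fromPred P? = tabulate (λ x → ⌊ P? x ⌋)

∈fromPred⁺ : ∀ {P : Fin n → Set} (P? : ∀ x → Dec (P x)) {x} → P x → x ∈ fromPred P?
∈fromPred⁺ P? {x} px with P? x in eq
... | yes _ = Vec.lookup⇒[]= x _ (trans (Vec.lookup∘tabulate _ x) (cong ⌊_⌋ eq))
... | no ¬p = contradiction px ¬p

∈fromPred⁻ : ∀ {P : Fin n → Set} (P? : ∀ x → Dec (P x)) {x} → x ∈ fromPred P? → P x
∈fromPred⁻ P? {x} h with P? x | trans (sym (Vec.lookup∘tabulate (λ x → ⌊ P? x ⌋) x)) (Vec.[]=⇒lookup h)
... | yes px | _ = px
... | no _   | ()

-- Separations

≤ₛ-refl : {s : Sep n} → s ≤ₛ s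
≤ₛ-refl = ⊆-refl , ⊆-refl

≤ₛ-trans : {s t u : Sep n} → s ≤ₛ t → t ≤ₛ u → s ≤ₛ u
≤ₛ-trans (a , b) (c , d) = ⊆-trans a c , ⊆-trans d b

inv-anti : {s t : Sep n} → s ≤ₛ t → inv t ≤ₛ inv s
inv-anti (a , b) = b , a

_≟ₛ_ : (s t : Sep n) → Dec (s ≡ t)
_≟ₛ_ = ≡-dec (Vec.≡-dec Bool._≟_) (Vec.≡-dec Bool._≟_)

_≤ₛ?_ : (s t : Sep n) → Dec (s ≤ₛ t)
(A , B) ≤ₛ? (C , D) = (A ⊆? C) ×-dec (D ⊆? B)

any-Sep? : {P : Sep n → Set} → (∀ s → Dec (P s)) → Dec (∃ P)
any-Sep? P? = map′ (λ (A , B , p) → (A , B) , p) (λ ((A , B) , p) → A , B , p)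
                   (anySubset? λ A → anySubset? λ B → P? (A , B))

argmin : {P : Sep n → Set} (P? : ∀ s → Dec (P s)) (f : Sep n → ℕ) →
         ∃ P → ∃ λ s → P s × (∀ r → P r → f s ≤ f r)
argmin {P = P} P? f (s , ps) = go s ps (<-wellFounded (f s))
  where
    go : ∀ s → P s → Acc _<_ (f s) → ∃ λ s → P s × (∀ r → P r → f s ≤ f r)
    go s ps (acc rec) with any-Sep? (λ r → P? r ×-dec (f r <? f s))
    ... | yes (r , pr , r<s) = go r pr (rec r<s)
    ... | no  none           = s , ps , λ r pr → ℕ.≮⇒≥ (λ r<s → none (r , pr , r<s))

allSubsets : ∀ n → List (Subset n)
allSubsets zero    = [] ∷ []
allSubsets (suc n) = map (true ∷_) (allSubsets n) ++ map (false ∷_) (allSubsets n)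

∈allSubsets : (p : Subset n) → p ∈ₗ allSubsets n
∈allSubsets []          = here refl
∈allSubsets (true  ∷ p) = ∈-++⁺ˡ (∈-map⁺ (true ∷_) (∈allSubsets p))
∈allSubsets (false ∷ p) = ∈-++⁺ʳ (map (true ∷_) (allSubsets _)) (∈-map⁺ (false ∷_) (∈allSubsets p))

-- Duplicates are removed so that filtered sublists have distinct entries; for these the star
-- condition yields `AllPairs Nested`.
allSeps : ∀ n → List (Sep n)
allSeps n = deduplicate _≟ₛ_ (cartesianProduct (allSubsets n) (allSubsets n))

∈allSeps : (s : Sep n) → s ∈ₗ allSeps n
∈allSeps (A , B) = ∈-deduplicate⁺ _≟ₛ_ (∈-cartesianProduct⁺ (∈allSubsets A) (∈allSubsets B))

sublists : ∀ {A : Set} → List A → List (List A)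
sublists []       = [] ∷ []
sublists (x ∷ xs) = map (x ∷_) (sublists xs) ++ sublists xs

filter∈sublists : ∀ {A : Set} {P : A → Set} (P? : ∀ x → Dec (P x)) xs → filter P? xs ∈ₗ sublists xs
filter∈sublists P? []       = here refl
filter∈sublists P? (x ∷ xs) with P? x
... | yes _ = ∈-++⁺ˡ (∈-map⁺ (x ∷_) (filter∈sublists P? xs))
... | no _  = ∈-++⁺ʳ (map (x ∷_) (sublists xs)) (filter∈sublists P? xs)

-- The star relation, to be imposed on list positions: in `AllPairs Nested` a repeated entry must be
-- nested with itself, whereas `IsStar` exempts equal elements.
Nested : Sep n → Sep n → Set
Nested s t = s ≤ₛ inv t

interB-↭ : {σ τ : List (Sep n)} → σ ↭ τ → interB σ ≡ interB τ
interB-↭ ↭refl = refl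
interB-↭ (↭prep x p) = cong (proj₂ x ∩_) (interB-↭ p)
interB-↭ {σ = x ∷ y ∷ σ} {y ∷ x ∷ τ} (↭swap x y p) =
  trans (sym (∩-assoc (proj₂ x) (proj₂ y) (interB σ)))
  (trans (cong₂ _∩_ (∩-comm (proj₂ x) (proj₂ y)) (interB-↭ p))
         (∩-assoc (proj₂ y) (proj₂ x) (interB τ)))
interB-↭ (↭trans p q) = trans (interB-↭ p) (interB-↭ q)

Nested-↭ : {σ τ : List (Sep n)} → σ ↭ τ → AllPairs Nested σ → AllPairs Nested τ
Nested-↭ p = AllPairs-resp-↭ inv-anti (resp₂ Nested) (↭⇒↭ₛ p)
  where open import Data.List.Relation.Binary.Permutation.Setoid.Properties (setoid (Sep _)) using (AllPairs-resp-↭)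

module Separations {n : ℕ} (G : Graph n) where

  -- The positive form of the no-edge condition, convenient for meets and joins.
  Sep⁺ : Sep n → Set
  Sep⁺ (A , B) = (∀ x → x ∈ A ⊎ x ∈ B) ×
                 (∀ u v → E G u v ≡ true → (u ∈ A × v ∈ A) ⊎ (u ∈ B × v ∈ B))

  toSep⁺ : ∀ {s} → IsSeparation G s → Sep⁺ s
  toSep⁺ {A , B} (A∪B≡⊤ , none) = cover , edge
    where
      cover : ∀ x → x ∈ A ⊎ x ∈ B
      cover x = x∈p∪q⁻ A B (subst (x ∈_) (sym A∪B≡⊤) ∈⊤)
      absurd : ∀ {b} {P : Set} → b ≡ true → b ≡ false → P
      absurd refl ()
      edge : ∀ u v → E G u v ≡ true → (u ∈ A × v ∈ A) ⊎ (u ∈ B × v ∈ B)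
      edge u v uv with u ∈? A | u ∈? B | v ∈? A | v ∈? B
      ... | yes a | _     | yes c | _     = inj₁ (a , c)
      ... | _     | yes b | _     | yes d = inj₂ (b , d)
      ... | yes a | no ¬b | no ¬c | yes d = absurd uv (none u v a ¬b d ¬c)
      ... | no ¬a | yes b | yes c | no ¬d = absurd uv (trans (E-sym G u v) (none v u c ¬d b ¬a))
      ... | no ¬a | no ¬b | _     | _     = absurd refl (⊥-elim ([ ¬a , ¬b ]′ (cover u)))
      ... | _     | _     | no ¬c | no ¬d = absurd refl (⊥-elim ([ ¬c , ¬d ]′ (cover v)))

  fromSep⁺ : ∀ {s} → Sep⁺ s → IsSeparation G s
  fromSep⁺ {A , B} (cover , edge) =
    ⊆-antisym ⊆⊤ (λ {x} _ → x∈p∪q⁺ (cover x)) , none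
    where
      none : ∀ u v → u ∈ A → u ∉ B → v ∈ B → v ∉ A → E G u v ≡ false
      none u v _ u∉B _ v∉A with E G u v in uv
      ... | false = refl
      ... | true  with edge u v uv
      ...   | inj₁ (_ , v∈A) = contradiction v∈A v∉A
      ...   | inj₂ (u∈B , _) = contradiction u∈B u∉B

  _⊓_ : Sep n → Sep n → Sep n
  (A , B) ⊓ (C , D) = (A ∩ C , B ∪ D)

  inv⁺ : ∀ {s} → Sep⁺ s → Sep⁺ (inv s)
  inv⁺ (cover , edge) = (λ x → swap (cover x)) , (λ u v uv → swap (edge u v uv))
    where open Sum using (swap)

  ⊓⁺ : ∀ {s t} → Sep⁺ s → Sep⁺ t → Sep⁺ (s ⊓ t)
  ⊓⁺ {A , B} {C , D} (cover₁ , edge₁) (cover₂ , edge₂) = cover , edge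
    where
      cover : ∀ x → x ∈ A ∩ C ⊎ x ∈ B ∪ D
      cover x with cover₁ x | cover₂ x
      ... | inj₁ a | inj₁ c = inj₁ (x∈p∩q⁺ (a , c))
      ... | inj₂ b | _      = inj₂ (x∈p∪q⁺ (inj₁ b))
      ... | _      | inj₂ d = inj₂ (x∈p∪q⁺ (inj₂ d))
      edge : ∀ u v → E G u v ≡ true → (u ∈ A ∩ C × v ∈ A ∩ C) ⊎ (u ∈ B ∪ D × v ∈ B ∪ D)
      edge u v uv with edge₁ u v uv | edge₂ u v uv
      ... | inj₁ (a , a′) | inj₁ (c , c′) = inj₁ (x∈p∩q⁺ (a , c) , x∈p∩q⁺ (a′ , c′))
      ... | inj₂ (b , b′) | _             = inj₂ (x∈p∪q⁺ (inj₁ b) , x∈p∪q⁺ (inj₁ b′))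
      ... | _             | inj₂ (d , d′) = inj₂ (x∈p∪q⁺ (inj₂ d) , x∈p∪q⁺ (inj₂ d′))

  small⁺ : (A : Subset n) → Sep⁺ (A , ⊤)
  small⁺ A = (λ _ → inj₂ ∈⊤) , (λ _ _ _ → inj₂ (∈⊤ , ∈⊤))

  unionA : List (Sep n) → Subset n
  unionA σ = ⋃ (map proj₁ σ)

  -- The supremum of σ, inverted.
  ⨆inv⁺ : ∀ {σ} → All Sep⁺ σ → Sep⁺ (interB σ , unionA σ)
  ⨆inv⁺ []       = inv⁺ (small⁺ ⊥)
  ⨆inv⁺ (h ∷ hs) = ⊓⁺ (inv⁺ h) (⨆inv⁺ hs)

  unionA⊆ : ∀ {σ} {s : Sep n} → All (_≤ₛ s) σ → unionA σ ⊆ proj₁ s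
  unionA⊆ []                     x∈⊥ = contradiction x∈⊥ ∉⊥
  unionA⊆ {u ∷ σ} {s} ((A⊆ , _) ∷ h) x∈ with x∈p∪q⁻ (proj₁ u) (unionA σ) x∈
  ... | inj₁ x∈u = A⊆ x∈u
  ... | inj₂ x∈σ = unionA⊆ {σ} {s} h x∈σ

  ⊆interB : ∀ {σ} {s : Sep n} → All (_≤ₛ s) σ → proj₂ s ⊆ interB σ
  ⊆interB []             x∈ = ∈⊤
  ⊆interB {u ∷ σ} {s} ((_ , ⊆B) ∷ h) x∈ = x∈p∩q⁺ (⊆B x∈ , ⊆interB {σ} {s} h x∈)

  -- Up to inversion, `inv v ⊓ t` is the join of `v` and `inv t`, so this is the usual submodularity
  -- of the order.
  order-⊓ : ∀ (v t : Sep n) → order (v ⊓ inv t) + order (inv v ⊓ t) ≤ order v + order t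
  order-⊓ (U , W) (C , D) = ∣∣-submodular U D W C U ⊆-refl

  module _ (k : ℕ) where

    inv-Sk : ∀ {s} → InSk G k s → InSk G k (inv s)
    inv-Sk {A , B} (sep , o) = fromSep⁺ (inv⁺ (toSep⁺ sep)) , subst (λ p → ∣ p ∣ < k) (∩-comm A B) o

    small-Sk : ∀ {A} → ∣ A ∣ < k → InSk G k (A , ⊤)
    small-Sk {A} A<k = fromSep⁺ (small⁺ A) , ℕ.≤-<-trans (p⊆q⇒∣p∣≤∣q∣ (p∩q⊆p A ⊤)) A<k

    IsSeparation? : ∀ s → Dec (IsSeparation G s)
    IsSeparation? (A , B) =
      Vec.≡-dec Bool._≟_ (A ∪ B) ⊤ ×-dec
      all? λ u → all? λ v → (u ∈? A) →-dec (¬? (u ∈? B) →-dec ((v ∈? B) →-dec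
        (¬? (v ∈? A) →-dec (E G u v Bool.≟ false))))

    InSk? : ∀ s → Dec (InSk G k s)
    InSk? s = IsSeparation? s ×-dec (order s <? k)

  sep-small : ∀ {s} → IsSeparation G s → s ≤ₛ inv s → proj₂ s ≡ ⊤
  sep-small {A , B} sep (A⊆B , _) = ⊆-antisym ⊆⊤ (λ {x} _ → [ A⊆B , id ]′ (proj₁ (toSep⁺ sep) x))

-- Tangles from derivations

module Duality {n : ℕ} (G : Graph n) (w k : ℕ) (0<k : 0 < k) (k≤w : k ≤ w) where
  open Separations G

  -- Derivable X (A , B): there is a tree decomposition of the A-side, rooted towards B,
  -- each of whose leaves either is the small side of a separation in X or has a small bag.
  data Derivable (X : Sep n → Set) : Sep n → Set where
    leaf : ∀ {s} → X s → Derivable X s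
    node : ∀ {s} σ → InSk G k s → AllPairs Nested (inv s ∷ σ) → ∣ interB (inv s ∷ σ) ∣ < w →
           All (Derivable X) σ → Derivable X s

  children-≤ : ∀ {s : Sep n} {σ} → AllPairs Nested (inv s ∷ σ) → All (_≤ₛ s) σ
  children-≤ (h ∷ _) = All.map inv-anti h

  derivable-Sk : ∀ {X s} → (∀ {u} → X u → InSk G k u) → Derivable X s → InSk G k s
  derivable-Sk X⊆Sk (leaf x)         = X⊆Sk x
  derivable-Sk X⊆Sk (node _ h _ _ _) = h

  module _ {X Y : Sep n → Set} (P : Sep n → Set) (P-down : ∀ {s t} → s ≤ₛ t → P t → P s)
           (X⇒Y : ∀ {s} → P s → X s → Derivable Y s) where

    -- By `children-≤` every separation in a derivation lies below its root, so the downward closed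
    -- `P` passes from the root to each leaf, where `X⇒Y` replaces it.
    relax : ∀ {s} → P s → Derivable X s → Derivable Y s
    relaxs : ∀ {σ} → All P σ → All (Derivable X) σ → All (Derivable Y) σ

    relax p (leaf x) = X⇒Y p x
    relax p (node σ h nested small ds) =
      node σ h nested small (relaxs (All.map (λ u≤s → P-down u≤s p) (children-≤ nested)) ds)
    relaxs []       []       = []
    relaxs (p ∷ ps) (d ∷ ds) = relax p d ∷ relaxs ps ds

  -- The same star, with the edge towards u as the edge towards the root.
  turn : ∀ {X s u σ τ} → σ ↭ u ∷ τ → InSk G k u → Derivable X (inv s) → All (Derivable X) τ →
         AllPairs Nested (inv s ∷ σ) → ∣ interB (inv s ∷ σ) ∣ < w → Derivable X (inv u)
  turn {s = s} {u} {σ} {τ} p u∈Sk d ds nested small =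
    node (inv s ∷ τ) (inv-Sk k u∈Sk) (Nested-↭ q nested)
         (subst (λ B → ∣ B ∣ < w) (interB-↭ q) small) (d ∷ ds)
    where
      q : inv s ∷ σ ↭ u ∷ inv s ∷ τ
      q = ↭trans (↭prep (inv s) p) (↭swap (inv s) u ↭refl)

  module _ {X : Sep n → Set} {s : Sep n} (X⊆Sk : ∀ {u} → X u ⊎ u ≡ s → InSk G k u) where

    private X+s = λ u → X u ⊎ u ≡ s

    -- Either no leaf uses `s`, or some leaf is `s` and can become the root: `turn` is applied to
    -- each star on the way from the old root to that leaf, and the argument of the function fills
    -- the place of the old root. Other leaves `s` may remain.
    reroot : ∀ {v} → Derivable X+s v →
             Derivable X v ⊎ (Derivable X+s (inv v) → Derivable X+s (inv s))
    reroots : ∀ {σ} → All (Derivable X+s) σ →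
              All (Derivable X) σ ⊎
              (∃₂ λ u τ → σ ↭ u ∷ τ × (Derivable X+s (inv u) → Derivable X+s (inv s)))

    reroot (leaf (inj₁ x))    = inj₁ (leaf x)
    reroot (leaf (inj₂ refl)) = inj₂ λ d → d
    reroot (node σ v∈Sk nested small ds) with reroots ds
    ... | inj₁ ds′             = inj₁ (node σ v∈Sk nested small ds′)
    ... | inj₂ (u , τ , p , f) with All-resp-↭ p ds
    ...   | d ∷ ds′ = inj₂ λ e → f (turn p (derivable-Sk X⊆Sk d) e ds′ nested small)

    reroots [] = inj₁ []
    reroots {σ = u ∷ τ} (d ∷ ds) with reroot d | reroots ds
    ... | inj₂ f  | _                      = inj₂ (u , τ , ↭refl , f)
    ... | inj₁ d′ | inj₁ ds′               = inj₁ (d′ ∷ ds′)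
    ... | inj₁ _  | inj₂ (u′ , τ′ , p , f) =
      inj₂ (u′ , u ∷ τ′ , ↭trans (↭prep u p) (↭swap u u′ ↭refl) , f)

  record IsSmall (s : Sep n) : Set where
    constructor isSmall
    field
      ∣A∣<k : ∣ proj₁ s ∣ < k
      B≡⊤   : proj₂ s ≡ ⊤

  ∅V : Sep n
  ∅V = (⊥ , ⊤)

  ∅V-least : ∀ s → ∅V ≤ₛ s
  ∅V-least s = ⊥⊆ , ⊆⊤

  ∅V-small : IsSmall ∅V
  ∅V-small = isSmall (subst (_< k) (sym (∣⊥∣≡0 n)) 0<k) refl

  module _ {X : Sep n → Set} (X⊆Sk : ∀ {u} → X u → InSk G k u)
           (small⊆X : ∀ {u} → IsSmall u → X u) where

    -- Any leaf of the derivation of v becomes the root; a derivation without leaves is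
    -- first given the leaf (∅ , V).
    merge : ∀ {v} → Derivable X v → Derivable X (inv v) → ∃ λ u → X u × Derivable X (inv u)
    merge (leaf x) d′ = _ , x , d′
    merge {v} (node [] v∈Sk nested small []) d′ =
      ∅V , x , node (inv v ∷ []) (inv-Sk k (X⊆Sk x)) ((∅V-least v ∷ []) ∷ [] ∷ [])
                 (ℕ.≤-<-trans (p⊆q⇒∣p∣≤∣q∣ (p∩q⊆q ⊤ (interB (inv v ∷ [])))) small) (d′ ∷ [])
      where
        x : X ∅V
        x = small⊆X ∅V-small
    merge (node (u ∷ σ) v∈Sk nested small (d ∷ ds)) d′ =
      merge d (turn ↭refl (derivable-Sk X⊆Sk d) d′ ds nested small)

    -- `∅V` is nested with everything, and its B-side V leaves the bag unchanged, so it can be added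
    -- to the star as the edge towards the root.
    fromStar : ∀ σ → All X σ → AllPairs Nested σ → ∣ interB σ ∣ < w → Derivable X (inv ∅V)
    fromStar σ σ⊆X nested small =
      node σ (inv-Sk k (X⊆Sk (small⊆X ∅V-small)))
           (All.universal (λ u → ∅V-least (inv u)) σ ∷ nested)
           (ℕ.≤-<-trans (p⊆q⇒∣p∣≤∣q∣ (p∩q⊆q ⊤ (interB σ))) small) (All.map leaf σ⊆X)

  -- Shifting derivations to a separation of minimum order.

  module Shift {X : Sep n → Set} (X⊆Sk : ∀ {u} → X u → InSk G k u)
               (X-down : ∀ {u v} → InSk G k u → u ≤ₛ v → X v → X u)
               (s t : Sep n) (t∈Sk : InSk G k t) (s≤t : s ≤ₛ t)
               (t-min : ∀ q → IsSeparation G q → s ≤ₛ q → q ≤ₛ t → order t ≤ order q) where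

    shift : Sep n → Sep n
    shift v = v ⊓ inv t

    shift-≤ : ∀ {v} → shift v ≤ₛ v
    shift-≤ {U , W} = p∩q⊆p U (proj₂ t) , p⊆p∪q (proj₁ t)

    t⁺ : Sep⁺ t
    t⁺ = toSep⁺ (proj₁ t∈Sk)

    -- The opposite corner `q = inv v ⊓ t` lies between `s` and `t`, so its order is at least that
    -- of `t`; by submodularity the order of `shift v` is at most that of `v`.
    shift-Sk : ∀ {v} → v ≤ₛ inv s → InSk G k v → InSk G k (shift v)
    shift-Sk {v@(U , W)} (U⊆B , A⊆W) (v-sep , v-order) =
      fromSep⁺ (⊓⁺ (toSep⁺ v-sep) (inv⁺ t⁺)) ,
      ℕ.≤-<-trans (ℕ.+-cancelʳ-≤ (order q) _ _
        (ℕ.≤-trans (order-⊓ v t) (ℕ.+-monoʳ-≤ (order v) (t-min q q-sep s≤q q≤t)))) v-order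
      where
        q = inv v ⊓ t
        q-sep = fromSep⁺ (⊓⁺ (inv⁺ (toSep⁺ v-sep)) t⁺)
        s≤q : s ≤ₛ q
        s≤q = (λ x∈A → x∈p∩q⁺ (A⊆W x∈A , proj₁ s≤t x∈A)) ,
              (λ x∈ → [ U⊆B , proj₂ s≤t ]′ (x∈p∪q⁻ U (proj₂ t) x∈))
        q≤t : q ≤ₛ t
        q≤t = p∩q⊆q W (proj₁ t) , q⊆p∪q U (proj₂ t)

    Nested-shift : ∀ {u v} → Nested u v → Nested (shift u) (shift v)
    Nested-shift {u} {v} (a , b) =
      ⊆-trans (proj₁ (shift-≤ {u})) (⊆-trans a (p⊆p∪q (proj₁ t))) ,
      ⊆-trans (p∩q⊆p (proj₁ v) (proj₂ t)) (⊆-trans b (p⊆p∪q (proj₁ t)))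

    Nested-root : ∀ {v u} → Nested (inv v) u → Nested (inv (shift v)) (shift u)
    Nested-root {V₁ , V₂} {u} (V₂⊆ , ⊆V₁) =
      (λ x∈ → [ (λ h → x∈p∪q⁺ (inj₁ (V₂⊆ h))) , (λ h → x∈p∪q⁺ (inj₂ h)) ]′ (x∈p∪q⁻ V₂ (proj₁ t) x∈)) ,
      (λ x∈ → let a , b = x∈p∩q⁻ (proj₁ u) (proj₂ t) x∈ in x∈p∩q⁺ (⊆V₁ a , b))

    interB-shift : ∀ σ → interB (map shift σ) ⊆ interB σ ∪ proj₁ t
    interB-shift []      x∈ = x∈p∪q⁺ (inj₁ ∈⊤)
    interB-shift (u ∷ σ) x∈
      with x∈p∩q⁻ (proj₂ (shift u)) (interB (map shift σ)) x∈
    ... | a , b with x∈p∪q⁻ (proj₂ u) (proj₁ t) a | x∈p∪q⁻ (interB σ) (proj₁ t) (interB-shift σ b)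
    ...   | inj₁ c | inj₁ d = x∈p∪q⁺ (inj₁ (x∈p∩q⁺ (c , d)))
    ...   | inj₂ c | _      = x∈p∪q⁺ (inj₂ c)
    ...   | _      | inj₂ d = x∈p∪q⁺ (inj₂ d)

    -- The argument of `shift-Sk` with the supremum of `σ` in place of `v` in the opposite corner
    -- `q`. Since `σ` lies below `v`, `unionA σ` is contained in `U`, as `∣∣-submodular` asks.
    bag-shift : ∀ {v σ} → v ≤ₛ inv s → All (_≤ₛ v) σ → All (IsSeparation G) σ →
                ∣ interB (inv (shift v) ∷ map shift σ) ∣ ≤ ∣ interB (inv v ∷ σ) ∣
    bag-shift {v@(U , W)} {σ} (U⊆B , A⊆W) σ≤v seps =
      ℕ.≤-trans (p⊆q⇒∣p∣≤∣q∣ bag⊆)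
        (ℕ.+-cancelʳ-≤ (order q) _ _
          (ℕ.≤-trans (∣∣-submodular U (proj₂ t) (interB σ) (proj₁ t) (unionA σ) (unionA⊆ {s = v} σ≤v))
            (ℕ.+-monoʳ-≤ ∣ U ∩ interB σ ∣ (t-min q q-sep s≤q q≤t))))
      where
        q = (interB σ , unionA σ) ⊓ t
        q-sep = fromSep⁺ (⊓⁺ (⨆inv⁺ (All.map toSep⁺ seps)) t⁺)
        s≤q : s ≤ₛ q
        s≤q = (λ x∈A → x∈p∩q⁺ (⊆interB {σ} {v} σ≤v (A⊆W x∈A) , proj₁ s≤t x∈A)) ,
              (λ x∈ → [ (λ h → U⊆B (unionA⊆ {s = v} σ≤v h)) , proj₂ s≤t ]′ (x∈p∪q⁻ (unionA σ) (proj₂ t) x∈))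
        q≤t : q ≤ₛ t
        q≤t = p∩q⊆q (interB σ) (proj₁ t) , q⊆p∪q (unionA σ) (proj₂ t)
        bag⊆ : interB (inv (shift v) ∷ map shift σ) ⊆ (U ∩ proj₂ t) ∩ (interB σ ∪ proj₁ t)
        bag⊆ x∈ with x∈p∩q⁻ (U ∩ proj₂ t) _ x∈
        ... | a , b = x∈p∩q⁺ (a , interB-shift σ b)

    -- The derivation keeps its shape. Children lie below `v`, so the bound `inv s` is inherited,
    -- and shifted leaves stay in `X` by downward closure.
    shift-derivable : ∀ {v} → v ≤ₛ inv s → Derivable X v → Derivable X (shift v)
    shift-derivables : ∀ {σ} → All (_≤ₛ inv s) σ → All (Derivable X) σ → All (Derivable X) (map shift σ)

    shift-derivable v≤ (leaf x) = leaf (X-down (shift-Sk v≤ (X⊆Sk x)) shift-≤ x)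
    shift-derivable {v} v≤ (node σ v∈Sk nested@(h ∷ hs) small ds) =
      node (map shift σ) (shift-Sk v≤ v∈Sk)
        (All.map⁺ (All.map Nested-root h) ∷ AllPairs.map⁺ (AllPairs.map Nested-shift hs))
        (ℕ.≤-<-trans (bag-shift v≤ σ≤v (All.map (proj₁ ∘ derivable-Sk X⊆Sk) ds)) small)
        (shift-derivables (All.map (λ u≤v → ≤ₛ-trans u≤v v≤) σ≤v) ds)
      where σ≤v = children-≤ nested
    shift-derivables []       []       = []
    shift-derivables (p ∷ ps) (d ∷ ds) = shift-derivable p d ∷ shift-derivables ps ds

    shift-root : shift (inv s) ≡ inv t
    shift-root = cong₂ _,_
      (⊆-antisym (p∩q⊆q (proj₂ s) (proj₂ t)) (λ x∈ → x∈p∩q⁺ (proj₂ s≤t x∈ , x∈)))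
      (⊆-antisym (λ x∈ → [ proj₁ s≤t , id ]′ (x∈p∪q⁻ (proj₁ s) (proj₁ t) x∈)) (q⊆p∪q (proj₁ s) (proj₁ t)))

    derivable-shift : Derivable X (inv s) → Derivable X (inv t)
    derivable-shift d = subst (Derivable X) shift-root (shift-derivable ≤ₛ-refl d)

  -- Enlarging downward closed systems to a tangle or a conflict.

  record IsSystem (X : Sep n → Bool) : Set where
    field
      ⊆Sk     : ∀ {u} → X u ≡ true → InSk G k u
      down    : ∀ {u v} → InSk G k u → u ≤ₛ v → X v ≡ true → X u ≡ true
      small⊆X : ∀ {u} → IsSmall u → X u ≡ true

  DerivableFrom : (Sep n → Bool) → Sep n → Set
  DerivableFrom X = Derivable (λ u → X u ≡ true)

  -- A system containing both `u` and `inv u` is in conflict too, by a derivation consisting of one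
  -- leaf.
  Conflict : (Sep n → Bool) → Set
  Conflict X = ∃ λ u → X u ≡ true × DerivableFrom X (inv u)

  Unoriented : (Sep n → Bool) → Sep n → Set
  Unoriented X s = InSk G k s × X s ≡ false × X (inv s) ≡ false

  Unoriented? : ∀ X s → Dec (Unoriented X s)
  Unoriented? X s = InSk? k s ×-dec ((X s Bool.≟ false) ×-dec (X (inv s) Bool.≟ false))

  add : (Sep n → Bool) → Sep n → Sep n → Bool
  add X s u = X u ∨ ⌊ u ≟ₛ s ⌋

  add⁻ : ∀ X s {u} → add X s u ≡ true → X u ≡ true ⊎ u ≡ s
  add⁻ X s {u} h with X u | u ≟ₛ s
  ... | true  | _       = inj₁ refl
  ... | false | yes u≡s = inj₂ u≡s
  ... | false | no _ with () ← h

  add⁺ : ∀ X s {u} → X u ≡ true ⊎ u ≡ s → add X s u ≡ true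
  add⁺ X s {u} h with X u | u ≟ₛ s | h
  ... | true  | _      | _        = refl
  ... | false | yes _  | _        = refl
  ... | false | no u≢s | inj₂ u≡s = contradiction u≡s u≢s

  true⊎false : ∀ b → b ≡ true ⊎ b ≡ false
  true⊎false true  = inj₁ refl
  true⊎false false = inj₂ refl

  true≢false : ∀ {b} {P : Set} → b ≡ true → b ≡ false → P
  true≢false refl ()

  Unique⇒AllPairs : ∀ {A : Set} {R : A → A → Set} {xs : List A} → AllPairs _≢_ xs →
    (∀ x y → x ∈ₗ xs → y ∈ₗ xs → x ≢ y → R x y) → AllPairs R xs
  Unique⇒AllPairs []       f = []
  Unique⇒AllPairs (h ∷ hs) f =
    All.tabulate (λ {y} y∈ → f _ y (here refl) (there y∈) (All.lookup h y∈)) ∷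
    Unique⇒AllPairs hs (λ x y x∈ y∈ → f x y (there x∈) (there y∈))

  module _ {X : Sep n → Bool} (system : IsSystem X) where
    open IsSystem system

    BadStar : List (Sep n) → Set
    BadStar σ = All (λ u → X u ≡ true) σ × AllPairs Nested σ × ∣ interB σ ∣ < w

    BadStar? : ∀ σ → Dec (BadStar σ)
    BadStar? σ = All.all? (λ u → X u Bool.≟ true) σ ×-dec
                 (AllPairs.allPairs? (λ s t → s ≤ₛ? inv t) σ ×-dec (∣ interB σ ∣ <? w))

    -- This makes the search for a forbidden star finite: `σ` is replaced by the sublist of
    -- `allSeps` with the same elements, which has no repetitions and the same intersection of
    -- B-sides.
    canonical-BadStar : ∀ σ → All (λ u → X u ≡ true) σ → InF G w k σ → Any BadStar (sublists (allSeps n))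
    canonical-BadStar σ σ⊆X (_ , (_ , star) , small) =
      Any.map (λ {τ} eq → subst BadStar eq bad) (filter∈sublists (_∈ₗ? σ) (allSeps n))
      where
        open import Data.List.Membership.DecPropositional (_≟ₛ_ {n = n}) using () renaming (_∈?_ to _∈ₗ?_)
        open import Data.List.Relation.Unary.Unique.DecPropositional.Properties (_≟ₛ_ {n = n}) using (deduplicate-!)
        open import Data.List.Relation.Unary.Unique.Propositional.Properties using () renaming (filter⁺ to Unique-filter⁺)
        σ′ = filter (_∈ₗ? σ) (allSeps n)
        ∈σ : ∀ {s} → s ∈ₗ σ′ → s ∈ₗ σ
        ∈σ = proj₂ ∘ ∈-filter⁻ (_∈ₗ? σ) {xs = allSeps n}
        interB⊆ : interB σ′ ⊆ interB σ
        interB⊆ x∈ = ∈⋂⁺ (All.map⁺ (All.tabulate (λ {s} s∈σ →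
          All.lookup (All.map⁻ (∈⋂⁻ (map proj₂ σ′) x∈)) (∈-filter⁺ (_∈ₗ? σ) (∈allSeps s) s∈σ))))
        bad : BadStar σ′
        bad = All.tabulate (All.lookup σ⊆X ∘ ∈σ) ,
              Unique⇒AllPairs
                (Unique-filter⁺ (_∈ₗ? σ) (deduplicate-! (cartesianProduct (allSubsets n) (allSubsets n))))
                (λ s t s∈ t∈ → star s t (∈σ s∈) (∈σ t∈)) ,
              ℕ.≤-<-trans (p⊆q⇒∣p∣≤∣q∣ interB⊆) small

    -- A pair of mutually inverse elements and a forbidden star are both conflicts. Without them `X`
    -- is a tangle, consistency being downward closure.
    total⇒tangle : (∀ s → InSk G k s → X s ≡ true ⊎ X (inv s) ≡ true) → Conflict X ⊎ HasTangle G w k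
    total⇒tangle total with any-Sep? (λ s → (X s Bool.≟ true) ×-dec (X (inv s) Bool.≟ true))
    ... | yes (s , x , x′) = inj₁ (s , x , leaf x′)
    ... | no none with Any.any? BadStar? (sublists (allSeps n))
    ...   | yes bad = let σ , σ⊆X , nested , small = Any.satisfied bad in
                      inj₁ (∅V , small⊆X ∅V-small , fromStar ⊆Sk small⊆X σ σ⊆X nested small)
    ...   | no good = inj₂ (X , ((λ s → ⊆Sk) , total , λ s _ x x′ → ⊥-elim (none (s , x , x′))) ,
                            (λ s t s∈Sk _ _ s<t x′ x → none (s , down s∈Sk (proj₁ s<t) x , x′)) ,
                            (λ σ σ⊆X inF → good (canonical-BadStar σ σ⊆X inF)))

    unoriented-down : ∀ {r s} → r ≤ₛ s → InSk G k r → Unoriented X s → X r ≡ true ⊎ Unoriented X r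
    unoriented-down {r} r≤s r∈Sk (s∈Sk , _ , x′) with true⊎false (X r) | true⊎false (X (inv r))
    ... | inj₁ h | _      = inj₁ h
    ... | inj₂ h | inj₂ l = inj₂ (r∈Sk , h , l)
    ... | inj₂ h | inj₁ l = true≢false (down (inv-Sk k s∈Sk) (inv-anti r≤s) l) x′

    Minimal : Sep n → Set
    Minimal s = ∀ {r} → Unoriented X r → r ≤ₛ s → r ≡ s

    minimal-below : ∀ {s} → Unoriented X s → ∃ λ r → Unoriented X r × r ≤ₛ s × Minimal r
    minimal-below {s} us =
      let r , (ur , r≤s) , min = argmin (λ r → Unoriented? X r ×-dec (r ≤ₛ? s)) size (s , us , ≤ₛ-refl)
      in r , ur , r≤s , λ {q} uq q≤r → size-≡ q≤r (min q (uq , ≤ₛ-trans q≤r r≤s))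
      where
        -- Strictly monotone for `≤ₛ`, so that minimum size implies minimality.
        size : Sep n → ℕ
        size (A , B) = ∣ A ∣ + ∣ ∁ B ∣
        ∁-⊆ : {A B : Subset n} → ∁ A ⊆ ∁ B → B ⊆ A
        ∁-⊆ {A} h {x} x∈B with x ∈? A
        ... | yes x∈A = x∈A
        ... | no  x∉A = contradiction x∈B (x∈∁p⇒x∉p (h (x∉p⇒x∈∁p x∉A)))
        size-≡ : ∀ {q r} → q ≤ₛ r → size r ≤ size q → q ≡ r
        size-≡ {A , B} {C , D} (A⊆C , D⊆B) le = cong₂ _,_
          (⊆∧∣≥∣⇒≡ A⊆C (ℕ.+-cancelʳ-≤ (∣ ∁ B ∣) _ _ (ℕ.≤-trans (ℕ.+-monoʳ-≤ ∣ C ∣ (p⊆q⇒∣p∣≤∣q∣ ∁B⊆∁D)) le)))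
          (⊆-antisym (∁-⊆ (⊆-reflexive (sym ∁B≡∁D))) D⊆B)
          where
            ∁B⊆∁D : ∁ B ⊆ ∁ D
            ∁B⊆∁D = p⊆q⇒∁p⊇∁q D⊆B
            ∁B≡∁D : ∁ B ≡ ∁ D
            ∁B≡∁D = ⊆∧∣≥∣⇒≡ ∁B⊆∁D (ℕ.+-cancelˡ-≤ ∣ A ∣ _ _ (ℕ.≤-trans (ℕ.+-monoˡ-≤ ∣ ∁ D ∣ (p⊆q⇒∣p∣≤∣q∣ A⊆C)) le))

    -- Minimality preserves downward closure: by `unoriented-down` whatever lies below `s` is in `X`
    -- or unoriented, and in the latter case equals `s`.
    add-system : ∀ {s} → Unoriented X s → Minimal s → IsSystem (add X s)
    add-system {s} us@(s∈Sk , _) min = record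
      { ⊆Sk     = λ h → [ ⊆Sk , (λ { refl → s∈Sk }) ]′ (add⁻ X s h)
      ; down    = λ u∈Sk u≤v h → add⁺ X s ([ inj₁ ∘ down u∈Sk u≤v , (λ { refl → below u∈Sk u≤v }) ]′ (add⁻ X s h))
      ; small⊆X = λ small → add⁺ X s (inj₁ (small⊆X small))
      }
      where
        below : ∀ {u} → InSk G k u → u ≤ₛ s → X u ≡ true ⊎ u ≡ s
        below u∈Sk u≤s = Sum.map₂ (λ uu → min uu u≤s) (unoriented-down u≤s u∈Sk us)

    -- Otherwise the B-side would be V and the order `∣ A ∣`, so `s` would be small and hence
    -- already in `X`.
    unoriented-≰ : ∀ {s} → Unoriented X s → ¬ (s ≤ₛ inv s)
    unoriented-≰ {A , B} (s∈Sk@(sep , o) , x , _) s≤ = true≢false (small⊆X (isSmall A<k B≡⊤)) x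
      where
        B≡⊤ = sep-small sep s≤
        A<k : ∣ A ∣ < k
        A<k = ℕ.≤-<-trans (p⊆q⇒∣p∣≤∣q∣ {p = A} (λ x∈A → x∈p∩q⁺ (x∈A , subst (_ ∈_) (sym B≡⊤) ∈⊤))) o

    -- If `s` is a leaf of the derivation, rerooting there, with the old root `u` as a leaf, derives
    -- `inv s`. If `s` is no leaf, the derivation is one from `X`: a conflict when `u` is in `X`, a
    -- derivation of `inv s` when `u` is `s`.
    conflict-added : ∀ {s} → Unoriented X s → Conflict (add X s) → Conflict X ⊎ DerivableFrom X (inv s)
    conflict-added {s} us (u , x , d) = result (add⁻ X s x)
      where
        X+s = λ u → X u ≡ true ⊎ u ≡ s
        d′ : Derivable X+s (inv u)
        d′ = relax (λ _ → Unit.⊤) _ (λ _ h → leaf (add⁻ X s h)) _ d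
        +⊆Sk : ∀ {u} → X+s u → InSk G k u
        +⊆Sk = [ ⊆Sk , (λ { refl → proj₁ us }) ]′
        -- All separations in a derivation of inv s lie below inv s, so s is not among them.
        without-s : Derivable X+s (inv s) → DerivableFrom X (inv s)
        without-s = relax (_≤ₛ inv s) ≤ₛ-trans
          (λ { v≤ (inj₁ h) → leaf h ; v≤ (inj₂ refl) → contradiction v≤ (unoriented-≰ us) }) ≤ₛ-refl
        result : X+s u → Conflict X ⊎ DerivableFrom X (inv s)
        result xu with xu | reroot +⊆Sk d′
        ... | inj₁ h    | inj₁ e = inj₁ (u , h , e)
        ... | inj₂ refl | inj₁ e = inj₂ e
        ... | _         | inj₂ f = inj₂ (without-s (f (leaf xu)))

    -- One minimiser `t` between `r` and `inv s` serves two shifts, from `r` up to `t` and from `s`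
    -- up to `inv t`: inversion maps the separations between `s` and `inv t` to those between `t`
    -- and `inv s`, preserving order.
    derive-both : ∀ {r s} → r ≤ₛ inv s → InSk G k r → DerivableFrom X (inv r) → DerivableFrom X (inv s) → Conflict X
    derive-both {r} {s} r≤s* r∈Sk dr ds
      with argmin (λ q → IsSeparation? k q ×-dec ((r ≤ₛ? q) ×-dec (q ≤ₛ? inv s))) order
                  (r , proj₁ r∈Sk , ≤ₛ-refl , r≤s*)
    ... | t , (t-sep , r≤t , t≤s*) , min = merge ⊆Sk small⊆X dt (Shift.derivable-shift ⊆Sk down r t t∈Sk r≤t
            (λ q q-sep r≤q q≤t → min q (q-sep , r≤q , ≤ₛ-trans q≤t t≤s*)) dr)
      where
        t∈Sk : InSk G k t
        t∈Sk = t-sep , ℕ.≤-<-trans (min r (proj₁ r∈Sk , ≤ₛ-refl , r≤s*)) (proj₂ r∈Sk)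
        order-inv : ∀ q → order (inv q) ≡ order q
        order-inv (A , B) = cong ∣_∣ (∩-comm B A)
        dt : DerivableFrom X t
        dt = Shift.derivable-shift ⊆Sk down s (inv t) (inv-Sk k t∈Sk) (inv-anti t≤s*)
          (λ q q-sep s≤q q≤t* → subst₂ _≤_ (sym (order-inv t)) (order-inv q)
            (min (inv q) (fromSep⁺ (inv⁺ (toSep⁺ q-sep)) , ≤ₛ-trans r≤t (inv-anti q≤t*) , inv-anti s≤q))) ds

    -- One round of the search; `ih` is its outcome for systems with one more element.
    extend : (∀ {s} → Unoriented X s → IsSystem (add X s) → Conflict (add X s) ⊎ HasTangle G w k) →
             Conflict X ⊎ HasTangle G w k
    extend ih with any-Sep? (Unoriented? X)
    ... | no none = total⇒tangle total
      where
        total : ∀ s → InSk G k s → X s ≡ true ⊎ X (inv s) ≡ true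
        total s s∈Sk with true⊎false (X s) | true⊎false (X (inv s))
        ... | inj₁ h | _      = inj₁ h
        ... | _      | inj₁ h = inj₂ h
        ... | inj₂ h | inj₂ l = ⊥-elim (none (s , s∈Sk , h , l))
    ... | yes (s₀ , us₀) = first (minimal-below us₀)
      where
        attempt : ∀ {s} → Unoriented X s → Minimal s →
                  (Conflict X ⊎ HasTangle G w k) ⊎ DerivableFrom X (inv s)
        attempt us min with ih us (add-system us min)
        ... | inj₂ tangle = inj₁ (inj₂ tangle)
        ... | inj₁ c      = Sum.map₁ inj₁ (conflict-added us c)

        first : (∃ λ s → Unoriented X s × s ≤ₛ s₀ × Minimal s) → Conflict X ⊎ HasTangle G w k
        -- With `s` also `inv s` is unoriented. A minimal `r` below it may differ from `inv s`;
        -- `derive-both` bridges the gap.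
        first (s , us@(s∈Sk , x , x′) , _ , s-min) with minimal-below (inv-Sk k s∈Sk , x′ , x)
        ... | r , ur , r≤s* , r-min with attempt us s-min | attempt ur r-min
        ...   | inj₁ res | _        = res
        ...   | _        | inj₁ res = res
        ...   | inj₂ ds  | inj₂ dr  = inj₁ (derive-both r≤s* (proj₁ ur) dr ds)

  -- `L` contains everything outside `X` and loses the added separation in each round, so its length
  -- decreases.
  search : ∀ X → IsSystem X → (L : List (Sep n)) → (∀ s → X s ≡ false → s ∈ₗ L) → Acc _<_ (length L) →
           Conflict X ⊎ HasTangle G w k
  search X system L X⊆L (acc rec) = extend system λ {s} us system′ →
    search (add X s) system′ (filter (λ u → ¬? (u ≟ₛ s)) L) (cover s)
      (rec (filter-notAll (λ u → ¬? (u ≟ₛ s)) L (Any.map (λ s≡u u≢s → u≢s (sym s≡u)) (X⊆L s (proj₁ (proj₂ us))))))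
    where
      cover : ∀ s u → add X s u ≡ false → u ∈ₗ filter (λ u → ¬? (u ≟ₛ s)) L
      cover s u h with X u in eq | u ≟ₛ s
      ... | false | no u≢s = ∈-filter⁺ (λ u → ¬? (u ≟ₛ s)) (X⊆L u eq) u≢s
      ... | false | yes _ with () ← h

  IsSmall⇒Sk : ∀ {u} → IsSmall u → InSk G k u
  IsSmall⇒Sk (isSmall A<k refl) = small-Sk k A<k

  IsSmall? : ∀ s → Dec (IsSmall s)
  IsSmall? (A , B) = map′ (uncurry isSmall) (λ (isSmall A<k B≡⊤) → A<k , B≡⊤) ((∣ A ∣ <? k) ×-dec Vec.≡-dec Bool._≟_ B ⊤)

  tangle-or-derivation : HasTangle G w k ⊎ (∃ λ u → IsSmall u × Derivable IsSmall (inv u))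
  tangle-or-derivation = result (search X₀ system (allSeps n) (λ s _ → ∈allSeps s) (<-wellFounded _))
    where
      X₀ : Sep n → Bool
      X₀ s = ⌊ IsSmall? s ⌋
      sound : ∀ {u} → X₀ u ≡ true → IsSmall u
      sound {u} h with IsSmall? u
      ... | yes p = p
      ... | no _ with () ← h
      complete : ∀ {u} → IsSmall u → X₀ u ≡ true
      complete {u} h with IsSmall? u
      ... | yes _ = refl
      ... | no ¬h = contradiction h ¬h
      down : ∀ {u v} → u ≤ₛ v → IsSmall v → IsSmall u
      down (A⊆C , D⊆B) (isSmall C<k refl) = isSmall (ℕ.≤-<-trans (p⊆q⇒∣p∣≤∣q∣ A⊆C) C<k) (⊆-antisym ⊆⊤ D⊆B)
      system : IsSystem X₀
      system = record
        { ⊆Sk     = λ h → IsSmall⇒Sk (sound h)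
        ; down    = λ _ u≤v h → complete (down u≤v (sound h))
        ; small⊆X = complete
        }
      result : Conflict X₀ ⊎ HasTangle G w k → HasTangle G w k ⊎ (∃ λ u → IsSmall u × Derivable IsSmall (inv u))
      result (inj₂ tangle)      = inj₁ tangle
      result (inj₁ (u , x , d)) =
        inj₂ (u , sound x , relax (λ _ → Unit.⊤) _ (λ _ h → leaf (sound h)) _ d)

-- Walks in trees

start∈ : ∀ {m adj} {x y : Fin m} (p : Walk adj x y) → x ∈ₗ walkVerts p
start∈ (here _)   = here refl
start∈ (step _ _) = here refl

end∈ : ∀ {m adj} {x y : Fin m} (p : Walk adj x y) → y ∈ₗ walkVerts p
end∈ (here _)   = here refl
end∈ (step _ p) = there (end∈ p)

module Walks {m : ℕ} (T : Tree m) where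

  W : Fin m → Fin m → Set
  W = Walk (adj T)

  adj-≢ : ∀ {x y} → adj T x y ≡ true → x ≢ y
  adj-≢ {x} e refl with () ← trans (sym e) (adj-irr T x)

  adj-swap : ∀ {x y} → adj T x y ≡ true → adj T y x ≡ true
  adj-swap {x} {y} e = trans (adj-sym T y x) e

  second : ∀ {x y} → W x y → Fin m
  second (here x)         = x
  second (step {y = y} _ _) = y

  -- In a tree this is equivalent to being a path, but it is local and so survives prepending one
  -- edge. If `p` is trivial, `second p` is its only vertex and the condition is just that the edge
  -- is no loop.
  NonBacktracking : ∀ {x y} → W x y → Set
  NonBacktracking (here _)           = Unit.⊤
  NonBacktracking (step {x = x} _ p) = second p ≢ x × NonBacktracking p

  second∈ : ∀ {x y} (p : W x y) → second p ∈ₗ walkVerts p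
  second∈ (here _)   = here refl
  second∈ (step _ p) = there (start∈ p)

  prefix : ∀ {x y z} (p : W x z) → IsPath p → y ∈ₗ walkVerts p →
           Σ (W x y) λ q → IsPath q × (∀ {v} → v ∈ₗ walkVerts q → v ∈ₗ walkVerts p) ×
                           (y ≢ x → second q ≡ second p)
  prefix (here x)   path       (here refl) = here x , path , id , λ _ → refl
  prefix (step e p) path       (here refl) =
    here _ , ([] ∷ []) , (λ { (here refl) → here refl }) , λ y≢x → contradiction refl y≢x
  prefix (step e p) (x∉ ∷ path) (there y∈) with prefix p path y∈
  ... | q , path′ , q⊆p , _ =
    step e q , All.tabulate (All.lookup x∉ ∘ q⊆p) ∷ path′ ,
    (λ { (here refl) → here refl ; (there v∈) → there (q⊆p v∈) }) , λ _ → refl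

  -- If `x` recurred on `p`, the part of `p` from `y` to `x` would close up with the edge `e` to a
  -- cycle; it has at least three vertices because `p` does not return to `x` at once.
  nonBacktracking⇒path : ∀ {x y} (p : W x y) → NonBacktracking p → IsPath p
  nonBacktracking⇒path (here _) _ = [] ∷ []
  nonBacktracking⇒path (step {x = x} {y} e p) (turn≢ , nb) = All.tabulate fresh ∷ path
    where
      path = nonBacktracking⇒path p nb
      long : ∀ {a b} (q : W a b) → b ≢ a → second q ≢ b → 3 ≤ length (walkVerts q)
      long (here _)              b≢a _ = contradiction refl b≢a
      long (step _ (here _))     _ b≢b = contradiction refl b≢b
      long (step _ (step _ (here _)))   _ _ = s≤s (s≤s (s≤s z≤n))
      long (step _ (step _ (step _ _))) _ _ = s≤s (s≤s (s≤s z≤n))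
      fresh : ∀ {v} → v ∈ₗ walkVerts p → x ≢ v
      fresh v∈ refl with prefix p path v∈
      ... | q , path′ , _ , same =
        acyclic T (y , x , q , path′ , long q (adj-≢ e) (λ eq → turn≢ (trans (sym (same (adj-≢ e))) eq)) , e)

  path⇒nonBacktracking : ∀ {x y} (p : W x y) → IsPath p → NonBacktracking p
  path⇒nonBacktracking (here _)   _ = _
  path⇒nonBacktracking (step e p) (x∉ ∷ path) =
    (λ eq → All.lookup x∉ (second∈ p) (sym eq)) , path⇒nonBacktracking p path

  -- Running back along q and then along r would be a closed non-backtracking walk.
  no-divergence : ∀ {x y} (q r : W x y) → NonBacktracking q → NonBacktracking r → second q ≡ second r
  no-divergence q r nbq nbr with second q Fin.≟ second r
  ... | yes eq = eq
  ... | no neq = ⊥-elim (go q r nbq nbr neq)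
    where
      go : ∀ {x y} (q r : W x y) → NonBacktracking q → NonBacktracking r → second q ≢ second r → Empty.⊥
      go (here x)   (here _)   _ _ neq = neq refl
      go (here x)   (step e r) _ nbr _ with x∉ ∷ _ ← nonBacktracking⇒path (step e r) nbr =
        All.lookup x∉ (end∈ r) refl
      go (step e q) r (turn≢ , nbq) nbr neq =
        go q (step (adj-swap e) r) nbq ((λ eq → neq (sym eq)) , nbr) turn≢

  nonBacktracking-unique : ∀ {x y} (p q : W x y) → NonBacktracking p → NonBacktracking q → p ≡ q
  nonBacktracking-unique (here _)   (here _)   _ _ = refl
  nonBacktracking-unique (here _)   (step e q) nbp nbq = contradiction (no-divergence (here _) (step e q) nbp nbq) (adj-≢ e)
  nonBacktracking-unique (step e p) (here _)   nbp nbq = contradiction (no-divergence (here _) (step e p) nbq nbp) (adj-≢ e)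
  nonBacktracking-unique (step e p) (step f q) nbp nbq with no-divergence (step e p) (step f q) nbp nbq
  -- Edge proofs are equalities of Booleans, hence unique, so the walks agree even as terms.
  ... | refl = cong₂ step (Decidable⇒UIP.≡-irrelevant Bool._≟_ e f) (nonBacktracking-unique p q (proj₂ nbp) (proj₂ nbq))

  -- Each step that would be undone at once is cancelled against its reversal, so no new vertices
  -- appear.
  reduce : ∀ {x y} (p : W x y) →
           Σ (W x y) λ q → NonBacktracking q × (∀ {v} → v ∈ₗ walkVerts q → v ∈ₗ walkVerts p)
  reduce (here x) = here x , _ , id
  reduce (step {x = x} e p) with reduce p
  ... | q , nb , q⊆p with second q Fin.≟ x
  ...   | no neq = step e q , (neq , nb) , λ { (here refl) → here refl ; (there v∈) → there (q⊆p v∈) }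
  reduce (step e p) | here _ , nb , q⊆p | yes refl = contradiction refl (adj-≢ e)
  reduce (step e p) | step f q , nb , q⊆p | yes refl = q , proj₂ nb , λ v∈ → there (q⊆p (there v∈))

  penultimate : ∀ {x y} → W x y → Fin m
  penultimate (here x)                  = x
  penultimate (step {x = x} _ (here _)) = x
  penultimate (step _ p@(step _ _))     = penultimate p

  penultimate-step : ∀ {x y z} (e : adj T x y ≡ true) (p : W y z) → y ≢ z → penultimate (step e p) ≡ penultimate p
  penultimate-step e (here _)   y≢z = contradiction refl y≢z
  penultimate-step e (step _ _) _   = refl

  penultimate-adj : ∀ {x y z} (e : adj T x y ≡ true) (p : W y z) → adj T (penultimate (step e p)) z ≡ true
  penultimate-adj e (here _)   = e
  penultimate-adj e (step f p) = penultimate-adj f p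

  -- The neighbour of t towards s, or t if s is t.
  branch : Fin m → Fin m → Fin m
  branch t s = penultimate (proj₁ (reduce (connected T s t)))

  branch-path : ∀ {s t} (p : W s t) → NonBacktracking p → branch t s ≡ penultimate p
  branch-path {s} {t} p nb with reduce (connected T s t)
  ... | q , nb′ , _ = cong penultimate (nonBacktracking-unique q p nb′ nb)

  branch-self : ∀ t → branch t t ≡ t
  branch-self t = branch-path (here t) _

  branch-adj : ∀ {s t} → adj T s t ≡ true → branch t s ≡ s
  branch-adj {s} {t} e = branch-path (step e (here t)) ((λ eq → adj-≢ e (sym eq)) , _)

  adj-branch : ∀ {s t} → s ≢ t → adj T (branch t s) t ≡ true
  adj-branch {s} {t} s≢t with reduce (connected T s t)
  ... | here _ , _   = contradiction refl s≢t
  ... | step e p , _ = penultimate-adj e p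

  -- The path from `z` to `t` either starts with `y`, and dropping `z` gives the path from `y`, or
  -- is extended by `y`. Its last edge is the same.
  branch-const : ∀ {y z t} → adj T y z ≡ true → y ≢ t → z ≢ t → branch t y ≡ branch t z
  branch-const {y} {z} {t} e y≢t z≢t with reduce (connected T z t)
  ... | q , nb , _ with second q Fin.≟ y
  ...   | no neq = trans (branch-path (step e q) (neq , nb)) (penultimate-step e q z≢t)
  branch-const e y≢t z≢t | here _ , nb , _ | yes refl = contradiction refl (adj-≢ e)
  branch-const e y≢t z≢t | step f q , nb , _ | yes refl =
    trans (branch-path q (proj₂ nb)) (sym (penultimate-step f q y≢t))

  avoiding-const : ∀ {s s′} t (p : W s s′) → ¬ (t ∈ₗ walkVerts p) → branch t s ≡ branch t s′
  avoiding-const t (here _)   _  = refl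
  avoiding-const t (step e p) t∉ =
    trans (branch-const e (λ { refl → t∉ (here refl) }) (λ { refl → t∉ (there (start∈ p)) }))
          (avoiding-const t p (t∉ ∘ there))

  infix 4 _∈ₗ?_
  _∈ₗ?_ : ∀ (x : Fin m) xs → Dec (x ∈ₗ xs)
  x ∈ₗ? xs = Any.any? (x Fin.≟_) xs

  separates : ∀ {s s′} t (p : W s s′) → branch t s ≢ branch t s′ → t ∈ₗ walkVerts p
  separates t p neq with t ∈ₗ? walkVerts p
  ... | yes t∈ = t∈
  ... | no  t∉ = contradiction (avoiding-const t p t∉) neq

  module _ {x t : Fin m} (xt : adj T x t ≡ true) where

    -- Deleting the edge between `x` and `t` leaves two components. Both `branch t s ≡ x` and
    -- `branch x s ≢ t` place `s` in that of `x`; the claim is that they agree.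
    Opposite : Fin m → Set
    Opposite s = (branch t s ≡ x × branch x s ≢ t) ⊎ (branch t s ≢ x × branch x s ≡ t)

    private
      x≢t = adj-≢ xt

      at-x : Opposite x
      at-x = inj₁ (branch-adj xt , λ eq → x≢t (trans (sym (branch-self x)) eq))

      at-t : Opposite t
      at-t = inj₂ ((λ eq → x≢t (trans (sym eq) (branch-self t))) , branch-adj (adj-swap xt))

      next-to-x : ∀ {z} → adj T x z ≡ true → z ≢ t → Opposite z
      next-to-x e z≢t = inj₁ (trans (sym (branch-const e x≢t z≢t)) (branch-adj xt) ,
                              λ eq → z≢t (trans (sym (branch-adj (adj-swap e))) eq))

      next-to-t : ∀ {z} → adj T t z ≡ true → z ≢ x → Opposite z
      next-to-t e z≢x = inj₂ ((λ eq → z≢x (trans (sym (branch-adj (adj-swap e))) eq)) ,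
                              trans (sym (branch-const e (x≢t ∘ sym) z≢x)) (branch-adj (adj-swap xt)))

      -- A step avoiding `x` and `t` changes neither branch; after a step meeting one of them the
      -- side is known outright.
      propagate : ∀ {s s′} → W s s′ → Opposite s → Opposite s′
      propagate (here _) o = o
      propagate (step {x = y} {z} e p) o = propagate p (next (z Fin.≟ x) (z Fin.≟ t) (y Fin.≟ x) (y Fin.≟ t))
        where
          next : Dec (z ≡ x) → Dec (z ≡ t) → Dec (y ≡ x) → Dec (y ≡ t) → Opposite z
          next (yes refl) _ _ _ = at-x
          next _ (yes refl) _ _ = at-t
          next _ (no z≢t) (yes refl) _ = next-to-x e z≢t
          next (no z≢x) _ _ (yes refl) = next-to-t e z≢x
          next (no z≢x) (no z≢t) (no y≢x) (no y≢t) =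
            subst₂ (λ a b → (a ≡ x × b ≢ t) ⊎ (a ≢ x × b ≡ t)) (branch-const e y≢t z≢t) (branch-const e y≢x z≢x) o

    opposite : ∀ s → Opposite s
    opposite s = propagate (connected T x s) at-x

-- S_k-trees from tree decompositions

oneNode : Tree 1
oneNode = record
  { adj       = λ _ _ → false
  ; adj-sym   = λ _ _ → refl
  ; adj-irr   = λ _ → refl
  ; connected = λ { zero zero → here zero }
  ; acyclic   = λ { (_ , _ , _ , _ , _ , ()) }
  }

module _ {m : ℕ} (T : Tree m) (α : Fin m → Fin m → Sep n) (t : Fin m) where

  ∈-incoming⁻ : ∀ {s} → s ∈ₗ incoming T α t → ∃ λ x → adj T x t ≡ true × s ≡ α x t
  ∈-incoming⁻ {s} s∈ = let x , h = Any.satisfied (∈-concatMap⁻ edge {xs = allFin m} s∈) in x , at x h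
    where
      edge = λ x → if adj T x t then [ α x t ] else []
      at : ∀ x → s ∈ₗ edge x → adj T x t ≡ true × s ≡ α x t
      at x h with adj T x t | h
      ... | true | here eq = refl , eq

  ∈-incoming⁺ : ∀ {x} → adj T x t ≡ true → α x t ∈ₗ incoming T α t
  ∈-incoming⁺ {x} e = ∈-concatMap⁺ edge (Any.map (λ { refl → at }) (∈-allFin x))
    where
      edge = λ x → if adj T x t then [ α x t ] else []
      at : α x t ∈ₗ edge x
      at rewrite e = here refl

pred-<⁻ : ∀ a c → (ℤ.+ a ℤ.- ℤ.+ 1) ℤ.< (ℤ.+ c ℤ.- ℤ.+ 1) → a < c
pred-<⁻ a c h = ℕ.≰⇒> λ c≤a → ℤ.<⇒≱ h (ℤ.+-monoˡ-≤ (ℤ.- ℤ.+ 1) (ℤ.+≤+ c≤a))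

pred-<⁺ : ∀ {a c} → a < c → (ℤ.+ a ℤ.- ℤ.+ 1) ℤ.< (ℤ.+ c ℤ.- ℤ.+ 1)
pred-<⁺ a<c = ℤ.+-monoˡ-< (ℤ.- ℤ.+ 1) (ℤ.+<+ a<c)

module EdgeSeparations (G : Graph n) {m : ℕ} (T : Tree m) (V : Fin m → Subset n)
                       (decomposition : IsTreeDecomposition G T V) where
  open Walks T
  open Separations G

  private
    covers-vertex = proj₁ decomposition
    covers-edge   = proj₁ (proj₂ decomposition)
    path-bags     = proj₂ (proj₂ decomposition)

  Beyond : Fin m → Fin m → Fin n → Set
  Beyond x t v = ∃ λ s → branch t s ≡ x × v ∈ V s

  NotBeyond : Fin m → Fin m → Fin n → Set
  NotBeyond x t v = ∃ λ s → branch t s ≢ x × v ∈ V s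

  beyond? : ∀ x t v → Dec (Beyond x t v)
  beyond? x t v = any? λ s → (branch t s Fin.≟ x) ×-dec (v ∈? V s)

  notBeyond? : ∀ x t v → Dec (NotBeyond x t v)
  notBeyond? x t v = any? λ s → ¬? (branch t s Fin.≟ x) ×-dec (v ∈? V s)

  -- For an edge, the unions of the bags in the two components left by deleting it. Only branches at
  -- `t` are used, which makes the separations around `t` visibly nested; symmetry is `sep-inv`.
  sep : Fin m → Fin m → Sep n
  sep x t = fromPred (beyond? x t) , fromPred (notBeyond? x t)

  -- Nodes in different branches at `t` are joined by a path through `t`.
  bag-between : ∀ {s s′ t v} → branch t s ≢ branch t s′ → v ∈ V s → v ∈ V s′ → v ∈ V t
  bag-between {s} {s′} {t} neq v∈s v∈s′ with reduce (connected T s s′)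
  ... | p , nb , _ =
    path-bags s t s′ p (nonBacktracking⇒path p nb) (separates t p neq) (x∈p∩q⁺ (v∈s , v∈s′))

  both-sides⇒bag : ∀ {x t v} → Beyond x t v → NotBeyond x t v → v ∈ V t
  both-sides⇒bag (s , eq , v∈s) (s′ , neq , v∈s′) =
    bag-between (λ eq′ → neq (trans (sym eq′) eq)) v∈s v∈s′

  module _ {x t : Fin m} (xt : adj T x t ≡ true) where

    Beyond⇒NotBeyond : ∀ {v} → Beyond x t v → NotBeyond t x v
    Beyond⇒NotBeyond (s , eq , v∈s) with opposite xt s
    ... | inj₁ (_ , neq) = s , neq , v∈s
    ... | inj₂ (neq , _) = contradiction eq neq

    NotBeyond⇒Beyond : ∀ {v} → NotBeyond x t v → Beyond t x v
    NotBeyond⇒Beyond (s , neq , v∈s) with opposite xt s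
    ... | inj₁ (eq , _) = contradiction eq neq
    ... | inj₂ (_ , eq) = s , eq , v∈s

  sep-inv : ∀ {x t} → adj T x t ≡ true → sep t x ≡ inv (sep x t)
  sep-inv {x} {t} xt = cong₂ _,_
    (⊆-antisym (λ v∈ → ∈fromPred⁺ (notBeyond? x t) (Beyond⇒NotBeyond (adj-swap xt) (∈fromPred⁻ (beyond? t x) v∈)))
               (λ v∈ → ∈fromPred⁺ (beyond? t x) (NotBeyond⇒Beyond xt (∈fromPred⁻ (notBeyond? x t) v∈))))
    (⊆-antisym (λ v∈ → ∈fromPred⁺ (beyond? x t) (NotBeyond⇒Beyond (adj-swap xt) (∈fromPred⁻ (notBeyond? t x) v∈)))
               (λ v∈ → ∈fromPred⁺ (notBeyond? t x) (Beyond⇒NotBeyond xt (∈fromPred⁻ (beyond? x t) v∈))))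

  sep-IsSeparation : ∀ x t → IsSeparation G (sep x t)
  sep-IsSeparation x t = fromSep⁺ (cover , edge)
    where
      side : ∀ {u v} s → u ∈ V s → v ∈ V s → (u ∈ proj₁ (sep x t) × v ∈ proj₁ (sep x t)) ⊎
                                           (u ∈ proj₂ (sep x t) × v ∈ proj₂ (sep x t))
      side s u∈ v∈ with branch t s Fin.≟ x
      ... | yes eq = inj₁ (∈fromPred⁺ (beyond? x t) (s , eq , u∈) , ∈fromPred⁺ (beyond? x t) (s , eq , v∈))
      ... | no neq = inj₂ (∈fromPred⁺ (notBeyond? x t) (s , neq , u∈) , ∈fromPred⁺ (notBeyond? x t) (s , neq , v∈))
      cover : ∀ v → v ∈ proj₁ (sep x t) ⊎ v ∈ proj₂ (sep x t)
      cover v = let s , v∈ = covers-vertex v in Sum.map proj₁ proj₁ (side s v∈ v∈)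
      edge : ∀ u v → E G u v ≡ true → (u ∈ proj₁ (sep x t) × v ∈ proj₁ (sep x t)) ⊎
                                     (u ∈ proj₂ (sep x t) × v ∈ proj₂ (sep x t))
      edge u v uv = let s , u∈ , v∈ = covers-edge u v uv in side s u∈ v∈

  order-sep : ∀ {x t} → adj T x t ≡ true → order (sep x t) ≤ ∣ V x ∩ V t ∣
  order-sep {x} {t} xt = p⊆q⇒∣p∣≤∣q∣ λ {v} v∈ →
    let a , b = x∈p∩q⁻ (proj₁ (sep x t)) (proj₂ (sep x t)) v∈
        a′ = ∈fromPred⁻ (beyond? x t) a
        b′ = ∈fromPred⁻ (notBeyond? x t) b
    in x∈p∩q⁺ (both-sides⇒bag (NotBeyond⇒Beyond xt b′) (Beyond⇒NotBeyond xt a′) , both-sides⇒bag a′ b′)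

  -- If `v` is in the bag of some `s` other than `t`, it is on the A-side towards the branch of `s`;
  -- being on that B-side as well, it lies in `V t`.
  interB⊆bag : ∀ t → interB (incoming T sep t) ⊆ V t
  interB⊆bag t {v} v∈ with covers-vertex v
  ... | s , v∈s with s Fin.≟ t
  ...   | yes refl = v∈s
  ...   | no s≢t   = both-sides⇒bag (s , refl , v∈s)
    (∈fromPred⁻ (notBeyond? (branch t s) t)
      (All.lookup (All.map⁻ (∈⋂⁻ (map proj₂ (incoming T sep t)) v∈)) (∈-incoming⁺ T sep t (adj-branch s≢t))))

module _ (G : Graph n) (w k : ℕ) (k≤w : k ≤ w) where
  open Separations G

  smallGraph⇒SkTree : ∣ ⊤ {n} ∣ < k → HasSkTree G w k
  smallGraph⇒SkTree V<k = 0 , oneNode , (λ _ _ → ⊤ , ⊤) , (λ _ _ ()) , (λ _ _ ()) ,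
    λ t → [] , ((λ _ ()) , (λ _ _ ())) , ℕ.<-≤-trans V<k k≤w

  -- Stars must not contain `(V , V)`, the only separation equal to its inverse. It has order
  -- `∣ ⊤ ∣`, so it is excluded from S_k unless V has fewer than `k` vertices, in which case a
  -- single node with the empty star will do.
  TD⇒SkTree : HasSmallTD G w k → HasSkTree G w k
  TD⇒SkTree (m , T , V , decomposition , width , _ , adhesion) with ∣ ⊤ {n} ∣ <? k
  ... | yes V<k = smallGraph⇒SkTree V<k
  ... | no  V≮k = m , T , sep , sep-Sk , (λ x t → sep-inv) , bag
    where
      open EdgeSeparations G T V decomposition
      sep-Sk : ∀ x t → adj T x t ≡ true → InSk G k (sep x t)
      sep-Sk x t xt = sep-IsSeparation x t , ℕ.≤-<-trans (order-sep xt) (adhesion x t xt)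

      nondegenerate : ∀ {s} → InSk G k s → s ≢ inv s
      nondegenerate {A , B} (sep , o) eq = V≮k (ℕ.≤-<-trans (p⊆q⇒∣p∣≤∣q∣ ⊤⊆) o)
        where
          ⊤⊆ : ⊤ ⊆ A ∩ B
          ⊤⊆ {x} _ with proj₁ (toSep⁺ sep) x
          ... | inj₁ x∈A = x∈p∩q⁺ (x∈A , subst (x ∈_) (cong proj₁ eq) x∈A)
          ... | inj₂ x∈B = x∈p∩q⁺ (subst (x ∈_) (cong proj₂ eq) x∈B , x∈B)

      nested : ∀ {x x′ t} → x ≢ x′ → sep x t ≤ₛ inv (sep x′ t)
      nested {x} {x′} {t} x≢x′ = disjoint x≢x′ , disjoint (x≢x′ ∘ sym)
        where
          disjoint : ∀ {x x′} → x ≢ x′ → proj₁ (sep x t) ⊆ proj₂ (sep x′ t)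
          disjoint {x} {x′} x≢x′ v∈ = let s , eq , v∈s = ∈fromPred⁻ (beyond? x t) v∈ in
            ∈fromPred⁺ (notBeyond? x′ t) (s , (λ eq′ → x≢x′ (trans (sym eq) eq′)) , v∈s)

      bag : ∀ t → InF G w k (incoming T sep t)
      bag t = All.tabulate in-Sk ,
              ((λ s s∈ → nondegenerate (in-Sk s∈)) , star) ,
              ℕ.≤-<-trans (p⊆q⇒∣p∣≤∣q∣ (interB⊆bag t)) (pred-<⁻ _ _ (width t))
        where
          in-Sk : ∀ {s} → s ∈ₗ incoming T sep t → InSk G k s
          in-Sk s∈ with ∈-incoming⁻ T sep t s∈
          ... | x , xt , refl = sep-Sk x t xt
          star : ∀ s s′ → s ∈ₗ incoming T sep t → s′ ∈ₗ incoming T sep t → s ≢ s′ → s ≤ₛ inv s′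
          star s s′ s∈ s′∈ s≢s′ with ∈-incoming⁻ T sep t s∈ | ∈-incoming⁻ T sep t s′∈
          ... | x , _ , refl | x′ , _ , refl = nested λ { refl → s≢s′ refl }

-- Tangles exclude S_k-trees.

Unique⇒length≤ : ∀ {m} (xs : List (Fin m)) → AllPairs _≢_ xs → length xs ≤ m
Unique⇒length≤ {m} xs unique = ℕ.≮⇒≥ λ m<len →
  let i , j , i<j , eq = pigeonhole m<len (lookup xs) in distinct xs unique i<j eq
  where
    distinct : ∀ (xs : List (Fin m)) → AllPairs _≢_ xs → ∀ {i j} → i Fin.< j → lookup xs i ≢ lookup xs j
    distinct (x ∷ xs) (h ∷ hs) {zero}  {suc j} _         = All.lookup h (∈-lookup j)
    distinct (x ∷ xs) (h ∷ hs) {suc i} {suc j} (s≤s i<j) = distinct xs hs i<j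

-- Following the orientation of the tree edges never backtracks and never stops.
SkTree⇒¬tangle : (G : Graph n) (w k : ℕ) → HasSkTree G w k → ¬ HasTangle G w k
SkTree⇒¬tangle G w k (m , T , α , α-Sk , α-inv , stars) (O , (_ , orients , _) , _ , avoids) =
  -- A path with `suc (suc m)` vertices in a tree with `suc m`.
  let _ , _ , p , nb , len , _ = long-walk (suc m)
  in ℕ.<⇒≱ (ℕ.≤-reflexive (sym len)) (Unique⇒length≤ (walkVerts p) (nonBacktracking⇒path p nb))
  where
    open Walks T
    exit : ∀ t → ∃ λ x → adj T x t ≡ true × O (α x t) ≡ false
    exit t with any? (λ x → (adj T x t Bool.≟ true) ×-dec (O (α x t) Bool.≟ false))
    ... | yes found = found
    ... | no none   = contradiction (stars t) (avoids _ (All.tabulate λ s∈ → all-in s∈))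
      where
        all-in : ∀ {s} → s ∈ₗ incoming T α t → O s ≡ true
        all-in s∈ with ∈-incoming⁻ T α t s∈
        ... | x , xt , refl with O (α x t) in eq
        ...   | true  = refl
        ...   | false = contradiction (x , xt , eq) none

    -- The walk grows at its start `x`. The last component says that the edge behind `x` is oriented
    -- towards `x`, so `exit x` is not `second p`.
    long-walk : ∀ ℓ → ∃₂ λ x y → Σ (W x y) λ p → NonBacktracking p × length (walkVerts p) ≡ suc ℓ ×
                                                 (second p ≢ x → O (α (second p) x) ≡ true)
    long-walk zero = zero , zero , here zero , _ , refl , λ 0≢0 → contradiction refl 0≢0
    long-walk (suc ℓ) with long-walk ℓ
    ... | t , z , p , nb , len , inward with exit t
    ...   | x , xt , out = x , z , step xt p , (turn≢ , nb) , cong suc len , λ _ → O-out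
      where
        turn≢ : second p ≢ x
        turn≢ refl with () ← trans (sym (inward (adj-≢ xt))) out
        O-out : O (α t x) ≡ true
        O-out with orients (α x t) (α-Sk x t xt)
        ... | inj₁ h with () ← trans (sym h) out
        ... | inj₂ h = trans (cong O (α-inv x t xt)) h

-- Tree decompositions from derivations

module AddLeaf {m : ℕ} (T : Tree m) (parent : Fin m) where

  adj′ : Fin (suc m) → Fin (suc m) → Bool
  adj′ zero    zero    = false
  adj′ zero    (suc y) = ⌊ y Fin.≟ parent ⌋
  adj′ (suc x) zero    = ⌊ x Fin.≟ parent ⌋
  adj′ (suc x) (suc y) = adj T x y

  W′ : Fin (suc m) → Fin (suc m) → Set
  W′ = Walk adj′

  adj′-sym : ∀ x y → adj′ x y ≡ adj′ y x
  adj′-sym zero    zero    = refl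
  adj′-sym zero    (suc y) = refl
  adj′-sym (suc x) zero    = refl
  adj′-sym (suc x) (suc y) = adj-sym T x y

  adj′-irr : ∀ x → adj′ x x ≡ false
  adj′-irr zero    = refl
  adj′-irr (suc x) = adj-irr T x

  leaf-edge : adj′ (suc parent) zero ≡ true
  leaf-edge with parent Fin.≟ parent
  ... | yes _  = refl
  ... | no neq = contradiction refl neq

  leaf-neighbour : ∀ z → adj′ zero z ≡ true → z ≡ suc parent
  leaf-neighbour (suc y) e with y Fin.≟ parent
  ... | yes eq = cong suc eq
  ... | no _ with () ← e

  module _ (P : Fin (suc m) → Set) where

    -- The predicate `P` is carried along for two uses: trivial for connectedness, membership of a
    -- fixed vertex in the bags for `joined`.
    lift : ∀ {x y} (p : Walk (adj T) x y) → All (P ∘ suc) (walkVerts p) →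
           Σ (W′ (suc x) (suc y)) λ q → All P (walkVerts q)
    lift (here x)   (h ∷ []) = here (suc x) , h ∷ []
    lift (step e p) (h ∷ hs) = let q , hs′ = lift p hs in step e q , h ∷ hs′

    fromLeaf : ∀ {y} (p : Walk (adj T) parent y) → P zero → All (P ∘ suc) (walkVerts p) →
               Σ (W′ zero (suc y)) λ q → All P (walkVerts q)
    fromLeaf p h hs = let q , hs′ = lift p hs in step leaf-edge q , h ∷ hs′

    toLeaf : ∀ {x} (p : Walk (adj T) x parent) → P zero → All (P ∘ suc) (walkVerts p) →
             Σ (W′ (suc x) zero) λ q → All P (walkVerts q)
    toLeaf (here x)   h (h′ ∷ []) = step leaf-edge (here zero) , h′ ∷ h ∷ []
    toLeaf (step e p) h (h′ ∷ hs) = let q , hs′ = toLeaf p h hs in step e q , h′ ∷ hs′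

  connected′ : ∀ x y → W′ x y
  connected′ zero    zero    = here zero
  connected′ zero    (suc y) = proj₁ (fromLeaf (λ _ → Unit.⊤) (connected T parent y) _ (All.universal (λ _ → Unit.tt) _))
  connected′ (suc x) zero    = proj₁ (toLeaf (λ _ → Unit.⊤) (connected T x parent) _ (All.universal (λ _ → Unit.tt) _))
  connected′ (suc x) (suc y) = proj₁ (lift (λ _ → Unit.⊤) (connected T x y) (All.universal (λ _ → Unit.tt) _))

  parent∈ : ∀ {x} (q : W′ (suc x) zero) → suc parent ∈ₗ walkVerts q
  parent∈ {x} (step {y = zero}  e q) = here (sym (leaf-neighbour (suc x) (trans (adj′-sym zero (suc x)) e)))
  parent∈ (step {y = suc _} e q) = there (parent∈ q)

  -- A path between old nodes misses the leaf, which it could enter and leave only through `parent`.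
  project : ∀ {x y} (q : W′ (suc x) (suc y)) → IsPath q →
            Σ (Walk (adj T) x y) λ p → map suc (walkVerts p) ≡ walkVerts q
  project (here _) _ = here _ , refl
  project (step {y = suc _} e q) (_ ∷ path) = let p , eq = project q path in step e p , cong (_ ∷_) eq
  project {x} (step {y = zero}  e (step f q)) ((_ ∷ x∉) ∷ _) =
    contradiction (trans (leaf-neighbour (suc x) (trans (adj′-sym zero (suc x)) e)) (sym (leaf-neighbour _ f)))
                  (All.lookup x∉ (start∈ q))

  loop-trivial : ∀ {x} (q : W′ x x) → IsPath q → length (walkVerts q) ≡ 1
  loop-trivial (here _)   _        = refl
  loop-trivial (step _ q) (x∉ ∷ _) = contradiction refl (All.lookup x∉ (end∈ q))

  -- On a cycle through its end `zero`, the leaf would have two distinct neighbours; a cycle with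
  -- old ends projects to `T`.
  acyclic′ : ¬ HasCycle adj′
  acyclic′ (zero , zero , _ , _ , _ , ())
  acyclic′ (zero , suc y , step {y = z} e q , _ ∷ path , s≤s 2≤len , closing)
    with leaf-neighbour z e | leaf-neighbour (suc y) (trans (adj′-sym zero (suc y)) closing)
  ... | refl | refl with s≤s () ← ℕ.≤-trans 2≤len (ℕ.≤-reflexive (loop-trivial q path))
  acyclic′ (suc x , zero , step {y = suc _} e q , x∉ ∷ _ , _ , closing) =
    All.lookup x∉ (parent∈ q) (leaf-neighbour (suc x) closing)
  acyclic′ (suc x , zero , step {y = zero} e q , _ ∷ path , s≤s 2≤len , closing)
    with s≤s () ← ℕ.≤-trans 2≤len (ℕ.≤-reflexive (loop-trivial q path))
  acyclic′ (suc x , suc y , q , path , 3≤len , closing) with project q path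
  ... | p , eq = acyclic T (x , y , p ,
    AllPairs.map (λ neq eq′ → neq (cong suc eq′)) (AllPairs.map⁻ (subst (AllPairs _≢_) (sym eq) path)) ,
    subst (3 ≤_) (trans (cong length (sym eq)) (length-map suc (walkVerts p))) 3≤len , closing)

  addLeaf : Tree (suc m)
  addLeaf = record
    { adj = adj′ ; adj-sym = adj′-sym ; adj-irr = adj′-irr ; connected = connected′ ; acyclic = acyclic′ }

module Assemble {n : ℕ} (G : Graph n) (w k : ℕ) (0<k : 0 < k) (k≤w : k ≤ w) where
  open Separations G
  open Duality G w k 0<k k≤w

  -- A tree decomposition of the part of G met so far.
  record PartialTD : Set where
    field
      {size}   : ℕ
      tree     : Tree (suc size)
      bag      : Fin (suc size) → Subset n
      -- Any walk is allowed here, which makes extension by a leaf easy; `reduce` later produces the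
      -- path.
      joined   : ∀ {v} s t → v ∈ bag s → v ∈ bag t →
                 Σ (Walk (adj tree) s t) λ p → All (λ x → v ∈ bag x) (walkVerts p)
      width    : ∀ t → ∣ bag t ∣ < w
      adhesion : ∀ s t → adj tree s t ≡ true → ∣ bag s ∩ bag t ∣ < k

    Node : Set
    Node = Fin (suc size)

  open PartialTD

  singleBag : (A : Subset n) → ∣ A ∣ < w → PartialTD
  singleBag A A<w = record
    { tree     = oneNode
    ; bag      = λ _ → A
    ; joined   = λ { zero zero v∈ _ → here zero , v∈ ∷ [] }
    ; width    = λ _ → A<w
    ; adhesion = λ _ _ ()
    }

  -- By the last hypothesis a vertex shared by `Z` and an old bag is in the bag of `p`, so the nodes
  -- containing it remain connected.
  attach : (D : PartialTD) (p : Node D) (Z : Subset n) → ∣ Z ∣ < w → ∣ bag D p ∩ Z ∣ < k →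
           (∀ {v} t → v ∈ Z → v ∈ bag D t → v ∈ bag D p) → PartialTD
  attach D p Z Z<w pZ<k meets = record
    { tree     = addLeaf
    ; bag      = bag′
    ; joined   = joined′
    ; width    = λ { zero → Z<w ; (suc t) → width D t }
    ; adhesion = adhesion′
    }
    where
      open AddLeaf (tree D) p
      bag′ : Fin (suc (suc (size D))) → Subset n
      bag′ zero    = Z
      bag′ (suc t) = bag D t
      joined′ : ∀ {v} s t → v ∈ bag′ s → v ∈ bag′ t → Σ (W′ s t) λ q → All (λ x → v ∈ bag′ x) (walkVerts q)
      joined′ zero    zero    v∈Z _   = here zero , v∈Z ∷ []
      joined′ zero    (suc t) v∈Z v∈t = let q , h = joined D p t (meets t v∈Z v∈t) v∈t in fromLeaf _ q v∈Z h
      joined′ (suc s) zero    v∈s v∈Z = let q , h = joined D s p v∈s (meets s v∈Z v∈s) in toLeaf _ q v∈Z h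
      joined′ (suc s) (suc t) v∈s v∈t = let q , h = joined D s t v∈s v∈t in lift _ q h
      adhesion′ : ∀ s t → adj′ s t ≡ true → ∣ bag′ s ∩ bag′ t ∣ < k
      adhesion′ zero    (suc t) e with leaf-neighbour (suc t) e
      ... | refl = subst (λ B → ∣ B ∣ < k) (∩-comm (bag D p) Z) pZ<k
      adhesion′ (suc s) zero    e with leaf-neighbour (suc s) (trans (adj′-sym zero (suc s)) e)
      ... | refl = pZ<k
      adhesion′ (suc s) (suc t) e = adhesion D s t e

  record Extends (D D′ : PartialTD) : Set where
    field
      embed     : Node D → Node D′
      bag-embed : ∀ t → bag D′ (embed t) ≡ bag D t

  open Extends

  Extends-trans : ∀ {D₁ D₂ D₃} → Extends D₁ D₂ → Extends D₂ D₃ → Extends D₁ D₃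
  Extends-trans f g = record
    { embed     = embed g ∘ embed f
    ; bag-embed = λ t → trans (bag-embed g (embed f t)) (bag-embed f t) }

  _~_ : Fin n → Fin n → Set
  a ~ b = a ≡ b ⊎ E G a b ≡ true

  ~-side : ∀ {s a b} → IsSeparation G s → a ~ b → (a ∈ proj₁ s × b ∈ proj₁ s) ⊎ (a ∈ proj₂ s × b ∈ proj₂ s)
  ~-side {a = a} sep (inj₁ refl) = Sum.map (λ x → x , x) (λ x → x , x) (proj₁ (toSep⁺ sep) a)
  ~-side         sep (inj₂ e)    = proj₂ (toSep⁺ sep) _ _ e

  Met : PartialTD → Fin n → Set
  Met D v = ∃ λ t → v ∈ bag D t

  -- Vertices are covered as the pairs with a ≡ b.
  Covers : PartialTD → Subset n → Set
  Covers D U = ∀ {a b} → a ∈ U → b ∈ U → a ~ b → ∃ λ t → a ∈ bag D t × b ∈ bag D t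

  Covers-extends : ∀ {D D′ U} → Extends D D′ → Covers D U → Covers D′ U
  Covers-extends f covers a∈ b∈ a~b = let t , a∈t , b∈t = covers a∈ b∈ a~b in
    embed f t , subst (_ ∈_) (sym (bag-embed f t)) a∈t , subst (_ ∈_) (sym (bag-embed f t)) b∈t

  -- The A-side of `u` lies in the B-sides of all other elements by nestedness, and the separator
  -- lies in its own B-side. Thus a bag contains the separators towards all its children.
  separators⊆interB : ∀ {σ : List (Sep n)} → AllPairs Nested σ → All (λ u → proj₁ u ∩ proj₂ u ⊆ interB σ) σ
  separators⊆interB [] = []
  separators⊆interB {u ∷ σ} (h ∷ hs) =
    (λ x∈ → let a , b = x∈p∩q⁻ (proj₁ u) (proj₂ u) x∈ in
            x∈p∩q⁺ (b , ∈⋂⁺ (All.map⁺ (All.map (λ nested → proj₁ nested a) h)))) ∷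
    All.zipWith (λ {s} (nested , ⊆σ) {_} x∈ →
      x∈p∩q⁺ (proj₂ nested (proj₁ (x∈p∩q⁻ (proj₁ s) (proj₂ s) x∈)) , ⊆σ x∈)) (h , separators⊆interB hs)

  -- A vertex or edge not inside every B-side lies in the A-side of some `u` in `σ`, where it is
  -- already covered.
  interB-covers : ∀ {D σ U t} → All (λ u → Covers D (proj₁ u)) σ → All (IsSeparation G) σ →
                  U ∩ interB σ ⊆ bag D t → Covers D U
  interB-covers {D} {σ} {U} {t} covers seps Z⊆ {a} {b} a∈U b∈U a~b
    with All.all? (λ u → (a ∈? proj₂ u) ×-dec (b ∈? proj₂ u)) σ
  ... | yes all = t , Z⊆ (x∈p∩q⁺ (a∈U , ∈⋂⁺ (All.map⁺ (All.map proj₁ all)))) ,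
                      Z⊆ (x∈p∩q⁺ (b∈U , ∈⋂⁺ (All.map⁺ (All.map proj₂ all))))
  ... | no ¬all = covered covers seps (All.¬All⇒Any¬ (λ u → (a ∈? proj₂ u) ×-dec (b ∈? proj₂ u)) σ ¬all)
    where
      covered : ∀ {σ} → All (λ u → Covers D (proj₁ u)) σ → All (IsSeparation G) σ →
                Any (λ u → ¬ (a ∈ proj₂ u × b ∈ proj₂ u)) σ → ∃ λ t → a ∈ bag D t × b ∈ bag D t
      covered (_ ∷ cs) (_ ∷ ss) (there any)   = covered cs ss any
      covered (c ∷ _)  (s ∷ _)  (here ¬sideB) with ~-side s a~b
      ... | inj₁ (a∈ , b∈) = c a∈ b∈ a~b
      ... | inj₂ sideB     = contradiction sideB ¬sideB

  -- `met⁻` confines the new bags, so that all bags stay in the B-sides of the siblings still to be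
  -- inserted.
  record Extension (D : PartialTD) (New : Fin n → Set) (Covered : PartialTD → Set) : Set where
    field
      {result} : PartialTD
      extends  : Extends D result
      met⁻     : ∀ {v} → Met result v → Met D v ⊎ New v
      covered  : Covered result

  open Extension

  module _ (D : PartialTD) (p : Node D) {s : Sep n} (s∈Sk : InSk G k s)
           (separator⊆p : proj₁ s ∩ proj₂ s ⊆ bag D p) (D⊆ : ∀ t → bag D t ⊆ proj₂ s)
           (Z : Subset n) (Z⊆ : Z ⊆ proj₁ s) (Z<w : ∣ Z ∣ < w) where

    -- `Z` is on the A-side of `s` and the old bags are on the B-side, so they meet only in the
    -- separator, which has fewer than `k` vertices and lies in the bag of `p`.
    attachBelow : PartialTD
    attachBelow = attach D p Z Z<w
      (ℕ.≤-<-trans (p⊆q⇒∣p∣≤∣q∣ (λ x∈ → let a , b = x∈p∩q⁻ (bag D p) Z x∈ in x∈p∩q⁺ (Z⊆ b , D⊆ p a))) (proj₂ s∈Sk))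
      (λ t v∈Z v∈t → separator⊆p (x∈p∩q⁺ (Z⊆ v∈Z , D⊆ t v∈t)))

    attachBelow-extends : Extends D attachBelow
    attachBelow-extends = record { embed = suc ; bag-embed = λ _ → refl }

    attachBelow-met⁻ : ∀ {v} → Met attachBelow v → Met D v ⊎ v ∈ proj₁ s
    attachBelow-met⁻ (zero  , v∈Z) = inj₂ (Z⊆ v∈Z)
    attachBelow-met⁻ (suc t , v∈t) = inj₁ (t , v∈t)

  -- Insert the decomposition of the A-side of s = (A , B) below p into a partial
  -- decomposition that lives in B.
  insert : ∀ {s} → Derivable IsSmall s → (D : PartialTD) (p : Node D) → proj₁ s ∩ proj₂ s ⊆ bag D p →
           (∀ t → bag D t ⊆ proj₂ s) → Extension D (_∈ proj₁ s) (λ D′ → Covers D′ (proj₁ s))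
  -- All siblings hang below the same `p`. The vertices added for `u` lie in its A-side, hence in
  -- the B-sides of the later siblings.
  insertAll : ∀ {σ} → All (Derivable IsSmall) σ → AllPairs Nested σ → (D : PartialTD) (p : Node D) →
              All (λ u → proj₁ u ∩ proj₂ u ⊆ bag D p) σ → All (λ u → ∀ t → bag D t ⊆ proj₂ u) σ →
              Extension D (λ v → Any (λ u → v ∈ proj₁ u) σ) (λ D′ → All (λ u → Covers D′ (proj₁ u)) σ)

  insert {s} (leaf (isSmall A<k B≡⊤)) D p separator⊆p D⊆ = record
    { extends = attachBelow-extends D p s∈Sk separator⊆p D⊆ A ⊆-refl A<w
    ; met⁻    = attachBelow-met⁻ D p s∈Sk separator⊆p D⊆ A ⊆-refl A<w
    ; covered = λ a∈ b∈ _ → zero , a∈ , b∈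
    }
    where
      A = proj₁ s
      s∈Sk = IsSmall⇒Sk (isSmall A<k B≡⊤)
      A<w = ℕ.<-≤-trans A<k k≤w
  insert {s} (node σ s∈Sk nested@(_ ∷ nested′) Z<w ds) D p separator⊆p D⊆ = record
    { extends = Extends-trans {D} {D₁} (attachBelow-extends D p s∈Sk separator⊆p D⊆ Z Z⊆ Z<w) (extends rest)
    ; met⁻    = λ v∈ → [ attachBelow-met⁻ D p s∈Sk separator⊆p D⊆ Z Z⊆ Z<w ,
                                  inj₂ ∘ (λ any → fromAny σ≤s any) ]′ (met⁻ rest v∈)
    ; covered = interB-covers {D = result rest} {σ} {U = proj₁ s} {t = embed (extends rest) zero}
                  (covered rest) (All.map (proj₁ ∘ derivable-Sk IsSmall⇒Sk) ds)
                  (⊆-reflexive (sym (bag-embed (extends rest) zero)))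
    }
    where
      Z = interB (inv s ∷ σ)
      Z⊆ : Z ⊆ proj₁ s
      Z⊆ = p∩q⊆p (proj₁ s) (interB σ)
      σ≤s = children-≤ nested
      D₁ = attachBelow D p s∈Sk separator⊆p D⊆ Z Z⊆ Z<w
      fromAny : ∀ {σ v} → All (_≤ₛ s) σ → Any (λ u → v ∈ proj₁ u) σ → v ∈ proj₁ s
      fromAny (u≤s ∷ _) (here v∈)   = proj₁ u≤s v∈
      fromAny (_ ∷ σ≤s) (there any) = fromAny σ≤s any
      D₁⊆ : ∀ {τ} → All (_≤ₛ s) τ → Z ⊆ interB τ → All (λ u → ∀ t → bag D₁ t ⊆ proj₂ u) τ
      D₁⊆ []                  _  = []
      D₁⊆ {u ∷ τ} (u≤s ∷ τ≤s) Z⊆ =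
        (λ { zero x∈ → p∩q⊆p (proj₂ u) (interB τ) (Z⊆ x∈) ; (suc t) x∈ → proj₂ u≤s (D⊆ t x∈) }) ∷
        D₁⊆ τ≤s (λ x∈ → p∩q⊆q (proj₂ u) (interB τ) (Z⊆ x∈))
      rest : Extension D₁ (λ v → Any (λ u → v ∈ proj₁ u) σ) (λ D′ → All (λ u → Covers D′ (proj₁ u)) σ)
      rest = insertAll ds nested′ D₁ zero
        (All.zipWith (λ {u} (⊆σ , u≤s) {_} x∈ → x∈p∩q⁺ (proj₁ u≤s (p∩q⊆p (proj₁ u) (proj₂ u) x∈) , ⊆σ x∈))
          (separators⊆interB nested′ , σ≤s))
        (D₁⊆ σ≤s (p∩q⊆q (proj₁ s) (interB σ)))

  insertAll [] [] D p [] [] = record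
    { result  = D
    ; extends = record { embed = id ; bag-embed = λ _ → refl }
    ; met⁻    = inj₁
    ; covered = []
    }
  insertAll {u ∷ σ} (d ∷ ds) (h ∷ hs) D p (⊆p ∷ ⊆ps) (D⊆ ∷ D⊆s) = record
    { extends = Extends-trans (extends one) (extends rest)
    ; met⁻    = λ v∈ → [ (λ v∈₁ → Sum.map₂ here (met⁻ one v∈₁)) , inj₂ ∘ there ]′ (met⁻ rest v∈)
    ; covered = Covers-extends {U = proj₁ u} (extends rest) (covered one) ∷ covered rest
    }
    where
      one = insert d D p ⊆p D⊆
      rest : Extension (result one) (λ v → Any (λ u → v ∈ proj₁ u) σ) (λ D′ → All (λ u → Covers D′ (proj₁ u)) σ)
      rest = insertAll ds hs (result one) (embed (extends one) p)
        (All.map (λ ⊆p {_} x∈ → subst (_ ∈_) (sym (bag-embed (extends one) p)) (⊆p x∈)) ⊆ps)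
        (All.zipWith (λ (D⊆ , nested) t {_} x∈ →
          [ (λ (t′ , x∈′) → D⊆ t′ x∈′) , (λ x∈u → proj₁ nested x∈u) ]′ (met⁻ one (t , x∈))) (D⊆s , h))

  -- For `u = (A , V)` the insertion starts from the single bag `A`. The A-side of `inv u` is V, so
  -- all of `G` gets covered.
  derivation⇒TD : ∀ {u} → IsSmall u → Derivable IsSmall (inv u) → HasSmallTD G w k
  derivation⇒TD {A , _} (isSmall A<k refl) d = size D , tree D , bag D ,
    ((λ v → let t , v∈ , _ = covered D⁺ ∈⊤ ∈⊤ (inj₁ refl) in t , v∈) ,
     (λ u v uv → covered D⁺ ∈⊤ ∈⊤ (inj₂ uv)) , on-paths) ,
    (λ t → pred-<⁺ (width D t)) , 0<k , adhesion D
    where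
      D⁺ = insert d (singleBag A (ℕ.<-≤-trans A<k k≤w)) zero (p∩q⊆q ⊤ A) (λ _ → ⊆-refl)
      D = result D⁺
      open Walks (tree D)
      -- The given path is the only one, hence the reduction of the walk supplied by `joined`.
      on-paths : ∀ t₁ t₂ t₃ (p : W t₁ t₃) → IsPath p → t₂ ∈ₗ walkVerts p → bag D t₁ ∩ bag D t₃ ⊆ bag D t₂
      on-paths t₁ t₂ t₃ p path t₂∈ v∈ with x∈p∩q⁻ (bag D t₁) (bag D t₃) v∈
      ... | v∈₁ , v∈₃ with joined D t₁ t₃ v∈₁ v∈₃
      ...   | q , v∈q with reduce q
      ...     | r , nb , r⊆q with nonBacktracking-unique p r (path⇒nonBacktracking p path) nb
      ...       | refl = All.lookup v∈q (r⊆q t₂∈)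

theorem9p3 : ∀ {n} (G : Graph (suc n)) (w k : ℕ) → 0 < k → k ≤ w →
    (HasTangle G w k ⇔ (¬ HasSkTree G w k)) × ((¬ HasSkTree G w k) ⇔ (¬ HasSmallTD G w k))
theorem9p3 G w k 0<k k≤w =
  -- Both equivalences come from one cycle: a tangle excludes S_k-trees, no S_k-tree means no small
  -- tree decomposition, and this yields a tangle.
  mk⇔ tangle⇒¬tree (λ noTree → ¬TD⇒tangle (noTree ∘ TD⇒SkTree G w k k≤w)) ,
  mk⇔ (λ noTree → noTree ∘ TD⇒SkTree G w k k≤w) (λ noTD → tangle⇒¬tree (¬TD⇒tangle noTD))
  where
    open Duality G w k 0<k k≤w using (tangle-or-derivation)
    open Assemble G w k 0<k k≤w using (derivation⇒TD)

    tangle⇒¬tree : HasTangle G w k → ¬ HasSkTree G w k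
    tangle⇒¬tree tangle tree = SkTree⇒¬tangle G w k tree tangle

    ¬TD⇒tangle : ¬ HasSmallTD G w k → HasTangle G w k
    ¬TD⇒tangle noTD with tangle-or-derivation
    ... | inj₁ tangle          = tangle
    ... | inj₂ (_ , small , d) = contradiction (derivation⇒TD small d) noTD
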